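{- Let $G=(V,E)$ be a finite undirected graph and let $f:2^V\to\mathbb{Z}$ be weakly supermodular, symmetric and normalized. Suppose that there is some small cut, i.e., some $S\subseteq V$ with $\mathrm{def}(S)>0$. Let $A\subseteq V$ be a maximum-deficiency cut, i.e., $\mathrm{def}(A)=\max_{S\subseteq V}\mathrm{def}(S)$ (note that $\mathrm{def}(A)>0$ and $\emptyset\neq A\subsetneq V$). Let $\bar A=V-A$, and let $f_A$ and $f_{\bar A}$ be the restrictions of $f$ to $A$ and to $\bar A$ respectively. (a) $F\subseteq E$ is a feasible solution to $\mathrm{CR}\text{ - }(f,G)\text{ - }\mathrm{NDP}$ if and only if $F\supseteq\delta_G(A)$, $F(A)$ is a feasible solution to $\mathrm{CR}\text{ - }(f_A,G[A])\text{ - }\mathrm{NDP}$, and $F(\bar A)$ is a feasible solution to $\mathrm{CR}\text{ - }(f_{\bar A},G[\bar A])\text{ - }\mathrm{NDP}$. (b) $x\in\mathbb{R}_+^E$ is feasible to $(\mathrm{CRLP}_{f,G})$ if and only if $x_e=1$ for all $e\in\delta_G(A)$, $x^{A}$ is feasible to $(\mathrm{CRLP}_{f_A,G[A]})$, and $x^{\bar A}$ is feasible to $(\mathrm{CRLP}_{f_{\bar A},G[\bar A]})$.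
   Context: For a graph $D=(V_D,E_D)$, $S\subseteq V_D$ and $Z\subseteq E_D$: $\delta_D(S)$ is the set of edges of $D$ with exactly one end in $S$; $\delta_Z(S)=\delta_D(S)\cap Z$; $D[S]$ is the subgraph induced by $S$; $Z(S)$ is the set of edges of $Z$ with both ends in $S$. For $x\in\mathbb{R}^{E_D}$ and $Z\subseteq E_D$, $x(Z)=\sum_{e\in Z}x_e$, and $x^S=(x_e)_{e\in E_D(S)}$. A function $h:2^{U}\to\mathbb{R}$ is weakly supermodular if for all $A,B\subseteq U$, $h(A)+h(B)\le\max\{h(A\cap B)+h(A\cup B),\ h(A-B)+h(B-A)\}$; symmetric if $h(S)=h(U-S)$ for all $S$; normalized if $h(\emptyset)=h(U)=0$. The deficiency of $S\subseteq V$ is $\mathrm{def}(S)=f(S)-|\delta_G(S)|$. Restriction: for $\emptyset\ne S\subsetneq V$, with $\bar S=V-S$ and $Z=\delta_G(S)$, the restriction of $f$ to $S$ is $f_S:2^S\to\mathbb{Z}$ with $f_S(\emptyset)=f_S(S)=0$ and $f_S(T)=\max\{f(T)-|\delta_Z(T)|,\ f(T\cup\bar S)-|\delta_Z(T\cup\bar S)|\}$ for $\emptyset\ne T\subsetneq S$. For a graph $D=(V_D,E_D)$ and $h:2^{V_D}\to\mathbb{Z}$: $H\subseteq E_D$ is feasible for $\mathrm{CR}\text{ - }(h,D)\text{ - }\mathrm{NDP}$ if $|\delta_H(S)|\ge\min\{h(S),|\delta_D(S)|\}$ for all $S\subseteq V_D$. A vector $x\in\mathbb{R}^{E_D}$ is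 feasible to $(\mathrm{CRLP}_{h,D})$ if $x(\delta_D(S))\ge\min\{h(S),|\delta_D(S)|\}$ for all $S\subseteq V_D$ and $0\le x_e\le1$ for all $e\in E_D$. -}

module Defs where

open import Data.Bool.Base using (true; _∧_; _∨_; _xor_; if_then_else_)
open import Data.Bool.Properties using () renaming (_≟_ to _≟ᵇ_)
open import Data.Fin.Base using (Fin)
open import Data.Fin.Subset
  using (Subset; ⊥; _∈_; _⊆_; _∩_; _∪_; _─_; ∣_∣)
open import Data.Fin.Subset.Properties using (x∈p∩q⁺; x∈p∩q⁻)
open import Data.Integer.Base as ℤ using (ℤ; +_; 0ℤ; _⊔_; _⊓_)
open import Data.Nat.Base as ℕ using (ℕ)
import Data.Nat.Properties as ℕ
open import Data.Product.Base using (_×_; _,_; proj₁; proj₂; ∃-syntax)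
open import Data.Rational.Base as ℚ using (ℚ; 0ℚ; ½)
import Data.Rational.Literals as ℚ
import Data.Rational.Properties as ℚ
open import Data.Rational.Solver using (module +-*-Solver)
open import Data.Vec.Base using (lookup; tabulate)
open import Data.Vec.Functional using (Vector; foldr)
open import Data.Vec.Properties
  using (≡-dec; lookup∘tabulate; []=⇒lookup; lookup⇒[]=)
open import Relation.Binary.PropositionalEquality
  using (_≡_; refl; sym; trans; cong; subst)
open import Relation.Nullary.Decidable.Core using (⌊_⌋)

-- Real numbers as Cauchy sequences of rationals; two sequences denote the same
-- real when they are related by _≃ᵣ_.

record ℝ : Set where
  constructor mkℝ
  field
    seq    : ℕ → ℚ
    cauchy : ∀ ε → 0ℚ ℚ.< ε →
             ∃[ N ] (∀ i j → N ℕ.≤ i → N ℕ.≤ j → ℚ.∣ seq i ℚ.- seq j ∣ ℚ.≤ ε)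

open ℝ public

infix  4 _≤ᵣ_ _≃ᵣ_
infixl 6 _+ᵣ_

_≤ᵣ_ : ℝ → ℝ → Set
x ≤ᵣ y = ∀ ε → 0ℚ ℚ.< ε → ∃[ N ] (∀ i → N ℕ.≤ i → seq x i ℚ.≤ seq y i ℚ.+ ε)

_≃ᵣ_ : ℝ → ℝ → Set
x ≃ᵣ y = ∀ ε → 0ℚ ℚ.< ε → ∃[ N ] (∀ i → N ℕ.≤ i → ℚ.∣ seq x i ℚ.- seq y i ∣ ℚ.≤ ε)

fromℤ : ℤ → ℝ
fromℤ z .seq _ = ℚ.fromℤ z
fromℤ z .cauchy ε 0<ε = 0 , λ _ _ _ _ →
  subst (ℚ._≤ ε) (sym (cong ℚ.∣_∣ (ℚ.+-inverseʳ (ℚ.fromℤ z)))) (ℚ.<⇒≤ 0<ε)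

0ᵣ 1ᵣ : ℝ
0ᵣ = fromℤ (+ 0)
1ᵣ = fromℤ (+ 1)

private
  0<½* : ∀ {ε} → 0ℚ ℚ.< ε → 0ℚ ℚ.< ½ ℚ.* ε
  0<½* {ε} 0<ε = subst (ℚ._< ½ ℚ.* ε) (ℚ.*-zeroʳ ½) (ℚ.*-monoʳ-<-pos ½ 0<ε)

  ½+½ : ∀ ε → ½ ℚ.* ε ℚ.+ ½ ℚ.* ε ≡ ε
  ½+½ ε = trans (sym (ℚ.*-distribʳ-+ ε ½ ½)) (ℚ.*-identityˡ ε)

  interchange : ∀ a b c d → (a ℚ.+ b) ℚ.- (c ℚ.+ d) ≡ (a ℚ.- c) ℚ.+ (b ℚ.- d)
  interchange = solve 4 (λ a b c d → (a :+ b) :- (c :+ d) := (a :- c) :+ (b :- d)) refl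
    where open +-*-Solver

_+ᵣ_ : ℝ → ℝ → ℝ
(x +ᵣ y) .seq i = seq x i ℚ.+ seq y i
(x +ᵣ y) .cauchy ε 0<ε with cauchy x (½ ℚ.* ε) (0<½* 0<ε) | cauchy y (½ ℚ.* ε) (0<½* 0<ε)
... | M , p | N , q = M ℕ.⊔ N , λ i j M⊔N≤i M⊔N≤j → begin
  ℚ.∣ (seq x i ℚ.+ seq y i) ℚ.- (seq x j ℚ.+ seq y j) ∣
    ≡⟨ cong ℚ.∣_∣ (interchange (seq x i) (seq y i) (seq x j) (seq y j)) ⟩
  ℚ.∣ (seq x i ℚ.- seq x j) ℚ.+ (seq y i ℚ.- seq y j) ∣
    ≤⟨ ℚ.∣p+q∣≤∣p∣+∣q∣ (seq x i ℚ.- seq x j) (seq y i ℚ.- seq y j) ⟩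
  ℚ.∣ seq x i ℚ.- seq x j ∣ ℚ.+ ℚ.∣ seq y i ℚ.- seq y j ∣
    ≤⟨ ℚ.+-mono-≤ (p i j (ℕ.m⊔n≤o⇒m≤o M N M⊔N≤i) (ℕ.m⊔n≤o⇒m≤o M N M⊔N≤j))
                  (q i j (ℕ.m⊔n≤o⇒n≤o M N M⊔N≤i) (ℕ.m⊔n≤o⇒n≤o M N M⊔N≤j)) ⟩
  ½ ℚ.* ε ℚ.+ ½ ℚ.* ε
    ≡⟨ ½+½ ε ⟩
  ε ∎
  where open ℚ.≤-Reasoning

private variable
  n m : ℕ

infix 8 _⟨_⟩

-- x ⟨ Z ⟩ = Σ_{e ∈ Z} x_e
_⟨_⟩ : Vector ℝ m → Subset m → ℝ
x ⟨ Z ⟩ = foldr _+ᵣ_ 0ᵣ (λ e → if lookup Z e then x e else 0ᵣ)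

-- The subvector (x_e)_{e ∈ Z}, with ℝ^Z embedded in ℝ^m by zero extension.
_↾_ : Vector ℝ m → Subset m → Vector ℝ m
(x ↾ Z) e = if lookup Z e then x e else 0ᵣ

-- A finite graph whose vertices and edges are taken from the labels Fin n and
-- Fin m, so that a graph and its induced subgraphs share the same labels.
-- Edges are undirected: the order of the two ends plays no role below.
-- Parallel edges and loops are allowed.
record Graph (n m : ℕ) : Set where
  field
    V         : Subset n
    E         : Subset m
    end₁ end₂ : Fin m → Fin n
    ends∈V    : ∀ {e} → e ∈ E → end₁ e ∈ V × end₂ e ∈ V

open Graph public

δ : Graph n m → Subset n → Subset m
δ D S = E D ∩ tabulate (λ e → lookup S (end₁ D e) xor lookup S (end₂ D e))

δ[_] : Subset m → Graph n m → Subset n → Subset m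
δ[ Z ] D S = δ D S ∩ Z

-- The edges of Z with both ends in S.
within : Graph n m → Subset m → Subset n → Subset m
within D Z S = Z ∩ tabulate (λ e → lookup S (end₁ D e) ∧ lookup S (end₂ D e))

private
  ∧-split : ∀ a b → a ∧ b ≡ true → a ≡ true × b ≡ true
  ∧-split true true _ = refl , refl

induced : Graph n m → Subset n → Graph n m
induced D S .V    = V D ∩ S
induced D S .E    = within D (E D) S
induced D S .end₁ = end₁ D
induced D S .end₂ = end₂ D
induced D S .ends∈V {e} e∈ =
  let e∈E , e∈S = x∈p∩q⁻ (E D) _ e∈
      v₁ , v₂   = ends∈V D e∈E
      s₁ , s₂   = ∧-split _ _ (trans (sym (lookup∘tabulate _ e)) ([]=⇒lookup e∈S))
  in x∈p∩q⁺ (v₁ , lookup⇒[]= _ S s₁) , x∈p∩q⁺ (v₂ , lookup⇒[]= _ S s₂)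

-- A function 2^U → ℤ is represented by a function on all label sets, of which
-- only the values on subsets of U are ever constrained or used.
SetFunction : ℕ → Set
SetFunction n = Subset n → ℤ

WeaklySupermodular : Subset n → SetFunction n → Set
WeaklySupermodular U h = ∀ A B → A ⊆ U → B ⊆ U →
  h A ℤ.+ h B ℤ.≤ (h (A ∩ B) ℤ.+ h (A ∪ B)) ⊔ (h (A ─ B) ℤ.+ h (B ─ A))

Symmetric : Subset n → SetFunction n → Set
Symmetric U h = ∀ S → S ⊆ U → h S ≡ h (U ─ S)

Normalized : Subset n → SetFunction n → Set
Normalized U h = h ⊥ ≡ 0ℤ × h U ≡ 0ℤ

deficiency : Graph n m → SetFunction n → Subset n → ℤ
deficiency G f S = f S ℤ.- + ∣ δ G S ∣

MaximumDeficiencyCut : Graph n m → SetFunction n → Subset n → Set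
MaximumDeficiencyCut G f A =
  A ⊆ V G × (∀ S → S ⊆ V G → deficiency G f S ℤ.≤ deficiency G f A)

-- The restriction f_S, meant for ∅ ≠ S ⊊ V and evaluated at T ⊆ S.
restriction : Graph n m → SetFunction n → Subset n → SetFunction n
restriction G f S T =
  if ⌊ ≡-dec _≟ᵇ_ T ⊥ ⌋ ∨ ⌊ ≡-dec _≟ᵇ_ T S ⌋
  then 0ℤ
  else (f T ℤ.- + ∣ δ[ Z ] G T ∣) ⊔ (f (T ∪ S̅) ℤ.- + ∣ δ[ Z ] G (T ∪ S̅) ∣)
  where
  S̅ = V G ─ S
  Z = δ G S

-- Feasibility for CR-(h,D)-NDP.
FeasibleNDP : SetFunction n → Graph n m → Subset m → Set
FeasibleNDP h D H =
  H ⊆ E D × (∀ S → S ⊆ V D → h S ⊓ + ∣ δ D S ∣ ℤ.≤ + ∣ δ[ H ] D S ∣)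

-- Feasibility for (CRLP_{h,D}); coordinates of x outside E D are ignored.
FeasibleLP : SetFunction n → Graph n m → Vector ℝ m → Set
FeasibleLP h D x =
  (∀ S → S ⊆ V D → fromℤ (h S ⊓ + ∣ δ D S ∣) ≤ᵣ x ⟨ δ D S ⟩) ×
  (∀ e → e ∈ E D → 0ᵣ ≤ᵣ x e × x e ≤ᵣ 1ᵣ)

{-# OPTIONS --safe #-}

-- Write def_B for the deficiency of the restriction of f to B in G[B], and T = S ∩ A, T̅ = S ∩ A̅.
-- The restriction is designed so that def_A(T) dominates def(P) for both extensions P = T and
-- P = T ∪ A̅.  Uncrossing S with A, and complementing A ─ S, gives extensions P of T and Q of T̅ with
-- def(S) + def(A) ≤ def(P) + def(Q).  As def(A) is maximum and nonnegative, def(S) is at most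
-- def(P), def(Q) and def(P) + def(Q), which yields
--   min(def(S), 0) ≤ min(def_A(T), 0) + min(def_A̅(T̅), 0)
-- (if T = ∅ or T = A, then def_A(T) = 0 and its term just drops out; likewise for T̅),
-- i.e. the cut constraints of the two restrictions at T and T̅, together with x = 1 on δ(A), imply
-- the one of f at S.  Conversely, positivity of def(A) forces x = 1 on δ(A), and then the cut
-- constraints of f at the two extensions of T give that of the restriction at T.  Part (a) is
-- part (b) for incidence vectors.
module Submission where

open import Defs
open import Data.Bool.Base using (Bool; true; false; _∧_; _∨_; _xor_; not; if_then_else_)
import Data.Bool.Properties as Bool
open import Data.Empty using (⊥-elim) renaming (⊥ to Empty)
open import Data.Fin.Base using (Fin; zero; suc)
open import Data.Fin.Subset
  using (Subset; Nonempty; ⊥; _∈_; _∉_; _⊆_; _⊂_; _⊇_; _∩_; _∪_; _─_; ∣_∣)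
open import Data.Fin.Subset.Properties
open import Data.Integer.Base as ℤ using (ℤ; +_; 0ℤ; _<_; _⊓_; _⊔_)
import Data.Integer.Properties as ℤ
import Data.Integer.Tactic.RingSolver as ℤ-Solver
open import Data.Nat.Base as ℕ using (ℕ)
import Data.Nat.Properties as ℕ
import Data.Nat.Tactic.RingSolver as ℕ-Solver
open import Data.Product.Base using (_×_; _,_; proj₁; proj₂; ∃-syntax)
open import Data.Rational.Base as ℚ using (ℚ; 0ℚ; ½)
import Data.Rational.Literals as ℚ
import Data.Rational.Properties as ℚ
open import Data.Rational.Solver using (module +-*-Solver)
import Data.Rational.Unnormalised.Base as ℚᵘ
import Data.Rational.Unnormalised.Properties as ℚᵘ
open import Data.Sum.Base using (_⊎_; inj₁; inj₂)
open import Data.Vec.Base using ([]; _∷_; lookup; here; there)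
open import Data.Vec.Functional using (Vector)
open import Data.Vec.Properties
  using (≡-dec; lookup-zipWith; lookup-replicate; lookup∘tabulate; tabulate∘lookup;
         tabulate-cong; []=⇒lookup; lookup⇒[]=)
open import Function.Base using (_∘_)
open import Function.Bundles using (_⇔_; mk⇔)
open import Relation.Binary.Bundles using (Preorder)
open import Relation.Binary.PropositionalEquality
  using (_≡_; refl; sym; trans; cong; cong₂; subst; subst₂)
open import Relation.Nullary.Decidable
  using (Dec; yes; no; map′; _×-dec_; _→-dec_; toWitness)
open import Relation.Nullary.Negation using (contradiction)

private variable
  n m : ℕ

-- Real numbers

infix 4 _≐_

record _≐_ (x y : ℝ) : Set where
  constructor pointwise
  field at : ∀ i → seq x i ≡ seq y i

open _≐_

≐-trans : ∀ {x y z} → x ≐ y → y ≐ z → x ≐ z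
≐-trans p q .at i = trans (at p i) (at q i)

≐-sym : ∀ {x y} → x ≐ y → y ≐ x
≐-sym p .at i = sym (at p i)

+ᵣ-cong : ∀ {x x′ y y′} → x ≐ x′ → y ≐ y′ → x +ᵣ y ≐ x′ +ᵣ y′
+ᵣ-cong p q .at i = cong₂ ℚ._+_ (at p i) (at q i)

+ᵣ-identityʳ : ∀ x → x +ᵣ 0ᵣ ≐ x
+ᵣ-identityʳ x .at i = ℚ.+-identityʳ (seq x i)

≡⇒≐ : ∀ {x y} → x ≡ y → x ≐ y
≡⇒≐ refl .at _ = refl

0<½* : ∀ {ε} → 0ℚ ℚ.< ε → 0ℚ ℚ.< ½ ℚ.* ε
0<½* {ε} 0<ε = subst (ℚ._< ½ ℚ.* ε) (ℚ.*-zeroʳ ½) (ℚ.*-monoʳ-<-pos ½ 0<ε)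

½+½ : ∀ ε → ½ ℚ.* ε ℚ.+ ½ ℚ.* ε ≡ ε
½+½ ε = trans (sym (ℚ.*-distribʳ-+ ε ½ ½)) (ℚ.*-identityˡ ε)

p≤p+ε : ∀ p {ε} → 0ℚ ℚ.< ε → p ℚ.≤ p ℚ.+ ε
p≤p+ε p {ε} 0<ε =
  subst (ℚ._≤ p ℚ.+ ε) (ℚ.+-identityʳ p) (ℚ.+-monoʳ-≤ p (ℚ.<⇒≤ 0<ε))

+-cancelʳ-≤ : ∀ p q r → p ℚ.+ r ℚ.≤ q ℚ.+ r → p ℚ.≤ q
+-cancelʳ-≤ p q r p+r≤q+r =
  subst₂ ℚ._≤_ (cancel p r) (cancel q r) (ℚ.+-monoˡ-≤ (ℚ.- r) p+r≤q+r)
  where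
  open +-*-Solver
  cancel : ∀ s r → (s ℚ.+ r) ℚ.- r ≡ s
  cancel = solve 2 (λ s r → (s :+ r) :- r := s) refl

≤ᵣ-pointwise : ∀ x y → (∀ i → seq x i ℚ.≤ seq y i) → x ≤ᵣ y
≤ᵣ-pointwise x y x≤y ε 0<ε = 0 , λ i _ → ℚ.≤-trans (x≤y i) (p≤p+ε (seq y i) 0<ε)

≐⇒≤ᵣ : ∀ {x y} → x ≐ y → x ≤ᵣ y
≐⇒≤ᵣ {x} {y} x≐y = ≤ᵣ-pointwise x y (ℚ.≤-reflexive ∘ at x≐y)

≤ᵣ-trans : ∀ x y z → x ≤ᵣ y → y ≤ᵣ z → x ≤ᵣ z
≤ᵣ-trans x y z x≤y y≤z ε 0<ε with x≤y (½ ℚ.* ε) (0<½* 0<ε) | y≤z (½ ℚ.* ε) (0<½* 0<ε)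
... | M , p | N , q = M ℕ.⊔ N , λ i M⊔N≤i → begin
  seq x i                               ≤⟨ p i (ℕ.m⊔n≤o⇒m≤o M N M⊔N≤i) ⟩
  seq y i ℚ.+ ½ ℚ.* ε                   ≤⟨ ℚ.+-monoˡ-≤ (½ ℚ.* ε) (q i (ℕ.m⊔n≤o⇒n≤o M N M⊔N≤i)) ⟩
  (seq z i ℚ.+ ½ ℚ.* ε) ℚ.+ ½ ℚ.* ε     ≡⟨ ℚ.+-assoc (seq z i) (½ ℚ.* ε) (½ ℚ.* ε) ⟩
  seq z i ℚ.+ (½ ℚ.* ε ℚ.+ ½ ℚ.* ε)     ≡⟨ cong (seq z i ℚ.+_) (½+½ ε) ⟩
  seq z i ℚ.+ ε                         ∎
  where open ℚ.≤-Reasoning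

≤ᵣ-preorder : Preorder _ _ _
≤ᵣ-preorder = record
  { _≈_ = _≐_
  ; _≲_ = _≤ᵣ_
  ; isPreorder = record
    { isEquivalence = record
      { refl  = pointwise λ _ → refl
      ; sym   = ≐-sym
      ; trans = ≐-trans
      }
    ; reflexive = ≐⇒≤ᵣ
    ; trans = λ {x} {y} {z} → ≤ᵣ-trans x y z
    }
  }

open import Relation.Binary.Reasoning.Preorder ≤ᵣ-preorder

≤ᵣ-refl : ∀ x → x ≤ᵣ x
≤ᵣ-refl x = ≐⇒≤ᵣ {x} {x} (pointwise λ _ → refl)

+ᵣ-mono-≤ : ∀ {x x′ y y′} → x ≤ᵣ x′ → y ≤ᵣ y′ → x +ᵣ y ≤ᵣ x′ +ᵣ y′
+ᵣ-mono-≤ {x} {x′} {y} {y′} x≤x′ y≤y′ ε 0<ε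
  with x≤x′ (½ ℚ.* ε) (0<½* 0<ε) | y≤y′ (½ ℚ.* ε) (0<½* 0<ε)
... | M , p | N , q = M ℕ.⊔ N , λ i M⊔N≤i →
  ℚ.≤-trans
    (ℚ.+-mono-≤ (p i (ℕ.m⊔n≤o⇒m≤o M N M⊔N≤i)) (q i (ℕ.m⊔n≤o⇒n≤o M N M⊔N≤i)))
    (ℚ.≤-reflexive (trans (interchange (seq x′ i) (seq y′ i) (½ ℚ.* ε))
                          (cong (seq x′ i ℚ.+ seq y′ i ℚ.+_) (½+½ ε))))
  where
  open +-*-Solver
  interchange : ∀ a b c → (a ℚ.+ c) ℚ.+ (b ℚ.+ c) ≡ (a ℚ.+ b) ℚ.+ (c ℚ.+ c)
  interchange = solve 3 (λ a b c → (a :+ c) :+ (b :+ c) := (a :+ b) :+ (c :+ c)) refl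

+ᵣ-cancelʳ-≤ : ∀ x y z → x +ᵣ z ≤ᵣ y +ᵣ z → x ≤ᵣ y
+ᵣ-cancelʳ-≤ x y z x+z≤y+z ε 0<ε with x+z≤y+z ε 0<ε
... | N , p = N , λ i N≤i → +-cancelʳ-≤ (seq x i) (seq y i ℚ.+ ε) (seq z i)
  (subst (seq x i ℚ.+ seq z i ℚ.≤_) (swap (seq y i) (seq z i) ε) (p i N≤i))
  where
  open +-*-Solver
  swap : ∀ a b c → (a ℚ.+ b) ℚ.+ c ≡ (a ℚ.+ c) ℚ.+ b
  swap = solve 3 (λ a b c → (a :+ b) :+ c := (a :+ c) :+ b) refl

+ᵣ-cancelˡ-≤ : ∀ z x y → z +ᵣ x ≤ᵣ z +ᵣ y → x ≤ᵣ y
+ᵣ-cancelˡ-≤ z x y z+x≤z+y = +ᵣ-cancelʳ-≤ x y z (begin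
  x +ᵣ z  ≈⟨ pointwise (λ i → ℚ.+-comm (seq x i) (seq z i)) ⟩
  z +ᵣ x  ≲⟨ z+x≤z+y ⟩
  z +ᵣ y  ≈⟨ pointwise (λ i → ℚ.+-comm (seq z i) (seq y i)) ⟩
  y +ᵣ z  ∎)

p≤∣p∣ : ∀ p → p ℚ.≤ ℚ.∣ p ∣
p≤∣p∣ p with ℚ.≤-total 0ℚ p
... | inj₁ 0≤p = ℚ.≤-reflexive (sym (ℚ.0≤p⇒∣p∣≡p 0≤p))
... | inj₂ p≤0 = ℚ.≤-trans p≤0 (ℚ.0≤∣p∣ p)

p≤q+∣p-q∣ : ∀ p q → p ℚ.≤ q ℚ.+ ℚ.∣ p ℚ.- q ∣
p≤q+∣p-q∣ p q =
  subst (ℚ._≤ q ℚ.+ ℚ.∣ p ℚ.- q ∣) (cancel p q) (ℚ.+-monoʳ-≤ q (p≤∣p∣ (p ℚ.- q)))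
  where
  open +-*-Solver
  cancel : ∀ p q → q ℚ.+ (p ℚ.- q) ≡ p
  cancel = solve 2 (λ p q → q :+ (p :- q) := p) refl

∣p-q∣≡∣q-p∣ : ∀ p q → ℚ.∣ p ℚ.- q ∣ ≡ ℚ.∣ q ℚ.- p ∣
∣p-q∣≡∣q-p∣ p q = trans (cong ℚ.∣_∣ (flip p q)) (ℚ.∣-p∣≡∣p∣ (q ℚ.- p))
  where
  open +-*-Solver
  flip : ∀ p q → p ℚ.- q ≡ ℚ.- (q ℚ.- p)
  flip = solve 2 (λ p q → p :- q := :- (q :- p)) refl

≃ᵣ-sym : ∀ x y → x ≃ᵣ y → y ≃ᵣ x
≃ᵣ-sym x y x≃y ε 0<ε with x≃y ε 0<ε
... | N , p = N , λ i N≤i → subst (ℚ._≤ ε) (∣p-q∣≡∣q-p∣ (seq x i) (seq y i)) (p i N≤i)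

≃ᵣ⇒≤ᵣ : ∀ x y → x ≃ᵣ y → x ≤ᵣ y
≃ᵣ⇒≤ᵣ x y x≃y ε 0<ε with x≃y ε 0<ε
... | N , p = N , λ i N≤i →
  ℚ.≤-trans (p≤q+∣p-q∣ (seq x i) (seq y i)) (ℚ.+-monoʳ-≤ (seq y i) (p i N≤i))

p≤q+ε⇒p-q≤ε : ∀ p q ε → p ℚ.≤ q ℚ.+ ε → p ℚ.- q ℚ.≤ ε
p≤q+ε⇒p-q≤ε p q ε p≤q+ε = +-cancelʳ-≤ (p ℚ.- q) ε q
  (subst₂ ℚ._≤_ (cancel p q) (ℚ.+-comm q ε) p≤q+ε)
  where
  open +-*-Solver
  cancel : ∀ p q → p ≡ (p ℚ.- q) ℚ.+ q
  cancel = solve 2 (λ p q → p := (p :- q) :+ q) refl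

≤ᵣ-antisym : ∀ x y → x ≤ᵣ y → y ≤ᵣ x → x ≃ᵣ y
≤ᵣ-antisym x y x≤y y≤x ε 0<ε with x≤y ε 0<ε | y≤x ε 0<ε
... | M , p | N , q = M ℕ.⊔ N , λ i M⊔N≤i → bound (seq x i) (seq y i)
  (p≤q+ε⇒p-q≤ε (seq x i) (seq y i) ε (p i (ℕ.m⊔n≤o⇒m≤o M N M⊔N≤i)))
  (p≤q+ε⇒p-q≤ε (seq y i) (seq x i) ε (q i (ℕ.m⊔n≤o⇒n≤o M N M⊔N≤i)))
  where
  bound : ∀ p q → p ℚ.- q ℚ.≤ ε → q ℚ.- p ℚ.≤ ε → ℚ.∣ p ℚ.- q ∣ ℚ.≤ ε
  bound p q p-q≤ε q-p≤ε with ℚ.≤-total 0ℚ (p ℚ.- q)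
  ... | inj₁ 0≤p-q = subst (ℚ._≤ ε) (sym (ℚ.0≤p⇒∣p∣≡p 0≤p-q)) p-q≤ε
  ... | inj₂ p-q≤0 = subst (ℚ._≤ ε)
    (trans (sym (ℚ.0≤p⇒∣p∣≡p 0≤q-p)) (∣p-q∣≡∣q-p∣ q p)) q-p≤ε
    where
    open +-*-Solver
    0≤q-p : 0ℚ ℚ.≤ q ℚ.- p
    0≤q-p = subst (0ℚ ℚ.≤_)
      (solve 2 (λ p q → :- (p :- q) := q :- p) refl p q) (ℚ.neg-antimono-≤ p-q≤0)

-- Adding normalised rationals involves dividing out a gcd, so the equation is checked on
-- unnormalised fractions, where it is a polynomial identity over the integers.
fromℤ-homo-+ : ∀ a b → fromℤ (a ℤ.+ b) ≐ fromℤ a +ᵣ fromℤ b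
fromℤ-homo-+ a b .at _ = ℚ.toℚᵘ-injective (ℚᵘ.≃-sym
  (ℚᵘ.≃-trans (ℚ.toℚᵘ-homo-+ (ℚ.fromℤ a) (ℚ.fromℤ b)) (ℚᵘ.*≡* (lemma a b))))
  where
  lemma : ∀ a b → (a ℤ.* + 1 ℤ.+ b ℤ.* + 1) ℤ.* + 1 ≡ (a ℤ.+ b) ℤ.* (+ 1)
  lemma = ℤ-Solver.solve-∀

fromℤ-mono-≤ℚ : ∀ {a b} → a ℤ.≤ b → ℚ.fromℤ a ℚ.≤ ℚ.fromℤ b
fromℤ-mono-≤ℚ a≤b = ℚ.*≤* (ℤ.*-monoʳ-≤-nonNeg (+ 1) a≤b)

fromℤ-mono-≤ : ∀ {a b} → a ℤ.≤ b → fromℤ a ≤ᵣ fromℤ b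
fromℤ-mono-≤ {a} {b} a≤b = ≤ᵣ-pointwise (fromℤ a) (fromℤ b) λ _ → fromℤ-mono-≤ℚ a≤b

-- Distinct integers differ by at least 1, so the single tolerance ½ is enough: `b < a` would give
-- `1 + b ≤ b + ½`. This is how real cut constraints become integer ones again.
fromℤ-cancel-≤ : ∀ a b → fromℤ a ≤ᵣ fromℤ b → a ℤ.≤ b
fromℤ-cancel-≤ a b a≤b = ℤ.≮⇒≥ λ b<a →
  let N , p = a≤b ½ (ℚ.*<* (ℤ.+<+ (ℕ.s≤s ℕ.z≤n)))
      1+b≤b+½ : ℚ.fromℤ (+ 1) ℚ.+ ℚ.fromℤ b ℚ.≤ ½ ℚ.+ ℚ.fromℤ b
      1+b≤b+½ = subst₂ ℚ._≤_ (at (fromℤ-homo-+ (+ 1) b) 0) (ℚ.+-comm (ℚ.fromℤ b) ½)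
        (ℚ.≤-trans (fromℤ-mono-≤ℚ (ℤ.i<j⇒suc[i]≤j b<a)) (p N ℕ.≤-refl))
  in contradiction (+-cancelʳ-≤ (ℚ.fromℤ (+ 1)) ½ (ℚ.fromℤ b) 1+b≤b+½)
       λ { (ℚ.*≤* (ℤ.+≤+ (ℕ.s≤s ()))) }

-- Sums over edge sets

ι : Bool → ℕ
ι b = if b then 1 else 0

-- `P` is the disjoint union of `Q`, `R` and `T`. Counting multiplicities states covering and
-- disjointness in one equation per edge, from which both cardinalities and sums of `x` follow by
-- induction.
Splits : (P Q R T : Subset m) → Set
Splits P Q R T =
  ∀ e → ι (lookup P e) ≡ ι (lookup Q e) ℕ.+ ι (lookup R e) ℕ.+ ι (lookup T e)

∣∷∣ : ∀ b (P : Subset m) → ∣ b ∷ P ∣ ≡ ι b ℕ.+ ∣ P ∣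
∣∷∣ true  P = refl
∣∷∣ false P = refl

∣∣-split : (P Q R T : Subset m) → Splits P Q R T → ∣ P ∣ ≡ ∣ Q ∣ ℕ.+ ∣ R ∣ ℕ.+ ∣ T ∣
∣∣-split [] [] [] [] _ = refl
∣∣-split (p ∷ P) (q ∷ Q) (r ∷ R) (t ∷ T) s
  rewrite ∣∷∣ p P | ∣∷∣ q Q | ∣∷∣ r R | ∣∷∣ t T
        | s zero | ∣∣-split P Q R T (s ∘ suc)
  = interchange (ι q) (ι r) (ι t) (∣ Q ∣) (∣ R ∣) (∣ T ∣)
  where
  interchange : ∀ a b c d e f →
    (a ℕ.+ b ℕ.+ c) ℕ.+ (d ℕ.+ e ℕ.+ f) ≡ (a ℕ.+ d) ℕ.+ (b ℕ.+ e) ℕ.+ (c ℕ.+ f)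
  interchange = ℕ-Solver.solve-∀

-- Reduces inequalities between sums of two cut sizes to a check on the ends of a single edge.
∣∣-mono₂ : (P Q R T : Subset m) →
  (∀ e → ι (lookup P e) ℕ.+ ι (lookup Q e) ℕ.≤ ι (lookup R e) ℕ.+ ι (lookup T e)) →
  ∣ P ∣ ℕ.+ ∣ Q ∣ ℕ.≤ ∣ R ∣ ℕ.+ ∣ T ∣
∣∣-mono₂ [] [] [] [] _ = ℕ.z≤n
∣∣-mono₂ (p ∷ P) (q ∷ Q) (r ∷ R) (t ∷ T) s
  rewrite ∣∷∣ p P | ∣∷∣ q Q | ∣∷∣ r R | ∣∷∣ t T
  = subst₂ ℕ._≤_ (interchange (ι p) (ι q) (∣ P ∣) (∣ Q ∣)) (interchange (ι r) (ι t) (∣ R ∣) (∣ T ∣))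
      (ℕ.+-mono-≤ (s zero) (∣∣-mono₂ P Q R T (s ∘ suc)))
  where
  interchange : ∀ a b c d → (a ℕ.+ b) ℕ.+ (c ℕ.+ d) ≡ (a ℕ.+ c) ℕ.+ (b ℕ.+ d)
  interchange = ℕ-Solver.solve-∀

-- Here and below, the summands are passed explicitly: solving for them would unfold
-- rational addition and the η-expansions of ℝ.
⟨⟩-cong : (x y : Vector ℝ m) (P Q : Subset m) →
  (∀ e → (if lookup P e then x e else 0ᵣ) ≡ (if lookup Q e then y e else 0ᵣ)) →
  x ⟨ P ⟩ ≐ y ⟨ Q ⟩
⟨⟩-cong x y [] [] _ = pointwise λ _ → refl
⟨⟩-cong x y (p ∷ P) (q ∷ Q) s = pointwise λ i →
  cong₂ ℚ._+_ {seq (if p then x zero else 0ᵣ) i} {seq (if q then y zero else 0ᵣ) i}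
              {seq ((x ∘ suc) ⟨ P ⟩) i} {seq ((y ∘ suc) ⟨ Q ⟩) i}
    (cong (λ r → seq r i) (s zero)) (at (⟨⟩-cong (x ∘ suc) (y ∘ suc) P Q (s ∘ suc)) i)

term-split : ∀ x p q r t → ι p ≡ ι q ℕ.+ ι r ℕ.+ ι t →
  (if p then x else 0ᵣ) ≐
  (if q then x else 0ᵣ) +ᵣ (if r then x else 0ᵣ) +ᵣ (if t then x else 0ᵣ)
term-split x true true false false _ = pointwise λ i →
  sym (trans (ℚ.+-identityʳ (seq x i ℚ.+ 0ℚ)) (ℚ.+-identityʳ (seq x i)))
term-split x true false true false _ = pointwise λ i →
  sym (trans (ℚ.+-identityʳ (0ℚ ℚ.+ seq x i)) (ℚ.+-identityˡ (seq x i)))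
term-split x true false false true _ = pointwise λ i → sym (ℚ.+-identityˡ (seq x i))
term-split x false false false false _ = pointwise λ _ → refl
term-split x true true true _ ()
term-split x true true false true ()
term-split x true false true true ()
term-split x true false false false ()
term-split x false true _ _ ()
term-split x false false true _ ()
term-split x false false false true ()

⟨⟩-split : (x : Vector ℝ m) (P Q R T : Subset m) → Splits P Q R T →
  x ⟨ P ⟩ ≐ x ⟨ Q ⟩ +ᵣ x ⟨ R ⟩ +ᵣ x ⟨ T ⟩
⟨⟩-split x [] [] [] [] _ = pointwise λ _ → refl
⟨⟩-split x (p ∷ P) (q ∷ Q) (r ∷ R) (t ∷ T) s = pointwise λ i → trans
  (cong₂ ℚ._+_
    {seq (x₀ p) i} {seq (x₀ q +ᵣ x₀ r +ᵣ x₀ t) i}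
    {seq (x₁ ⟨ P ⟩) i} {seq (x₁ ⟨ Q ⟩ +ᵣ x₁ ⟨ R ⟩ +ᵣ x₁ ⟨ T ⟩) i}
    (at (term-split (x zero) p q r t (s zero)) i) (at (⟨⟩-split x₁ P Q R T (s ∘ suc)) i))
  (interchange (seq (x₀ q) i) (seq (x₀ r) i) (seq (x₀ t) i)
    (seq (x₁ ⟨ Q ⟩) i) (seq (x₁ ⟨ R ⟩) i) (seq (x₁ ⟨ T ⟩) i))
  where
  x₀ = λ b → if b then x zero else 0ᵣ
  x₁ = x ∘ suc
  open +-*-Solver
  interchange : ∀ a b c d e f →
    (a ℚ.+ b ℚ.+ c) ℚ.+ (d ℚ.+ e ℚ.+ f) ≡ (a ℚ.+ d) ℚ.+ (b ℚ.+ e) ℚ.+ (c ℚ.+ f)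
  interchange = solve 6 (λ a b c d e f →
    (a :+ b :+ c) :+ (d :+ e :+ f) := (a :+ d) :+ (b :+ e) :+ (c :+ f)) refl

⟨⟩-mono-≤ : (x y : Vector ℝ m) (P : Subset m) →
  (∀ e → e ∈ P → x e ≤ᵣ y e) → x ⟨ P ⟩ ≤ᵣ y ⟨ P ⟩
⟨⟩-mono-≤ x y [] _ = ≤ᵣ-refl 0ᵣ
⟨⟩-mono-≤ x y (p ∷ P) x≤y =
  +ᵣ-mono-≤ {if p then x zero else 0ᵣ} {if p then y zero else 0ᵣ}
            {(x ∘ suc) ⟨ P ⟩} {(y ∘ suc) ⟨ P ⟩}
    (head p (x≤y zero)) (⟨⟩-mono-≤ (x ∘ suc) (y ∘ suc) P (λ e → x≤y (suc e) ∘ there))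
  where
  head : ∀ p → (zero ∈ p ∷ P → x zero ≤ᵣ y zero) →
    (if p then x zero else 0ᵣ) ≤ᵣ (if p then y zero else 0ᵣ)
  head true  x≤y = x≤y here
  head false _   = ≤ᵣ-refl 0ᵣ

1⟨⟩ : (P : Subset m) → (λ _ → 1ᵣ) ⟨ P ⟩ ≐ fromℤ (+ ∣ P ∣)
1⟨⟩ [] = pointwise λ _ → refl
1⟨⟩ (true ∷ P) = pointwise λ i → trans
  (cong (seq 1ᵣ i ℚ.+_) (at (1⟨⟩ P) i)) (sym (at (fromℤ-homo-+ (+ 1) (+ ∣ P ∣)) i))
1⟨⟩ (false ∷ P) = pointwise λ i → trans
  (cong (seq 0ᵣ i ℚ.+_) (at (1⟨⟩ P) i)) (sym (at (fromℤ-homo-+ (+ 0) (+ ∣ P ∣)) i))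

⟨⟩≤∣∣ : (x : Vector ℝ m) (P : Subset m) → (∀ e → e ∈ P → x e ≤ᵣ 1ᵣ) → x ⟨ P ⟩ ≤ᵣ fromℤ (+ ∣ P ∣)
⟨⟩≤∣∣ x P x≤1 = begin
  x ⟨ P ⟩             ≲⟨ ⟨⟩-mono-≤ x (λ _ → 1ᵣ) P x≤1 ⟩
  (λ _ → 1ᵣ) ⟨ P ⟩    ≈⟨ 1⟨⟩ P ⟩
  fromℤ (+ ∣ P ∣)     ∎

∣∣≤⟨⟩ : (x : Vector ℝ m) (P : Subset m) → (∀ e → e ∈ P → 1ᵣ ≤ᵣ x e) → fromℤ (+ ∣ P ∣) ≤ᵣ x ⟨ P ⟩
∣∣≤⟨⟩ x P 1≤x = begin
  fromℤ (+ ∣ P ∣)     ≈⟨ ≐-sym (1⟨⟩ P) ⟩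
  (λ _ → 1ᵣ) ⟨ P ⟩    ≲⟨ ⟨⟩-mono-≤ (λ _ → 1ᵣ) x P 1≤x ⟩
  x ⟨ P ⟩             ∎

-- No coordinate exceeds 1 while the total reaches the number of edges; bounding all other
-- coordinates by 1 leaves at least 1 for the chosen one.
⟨⟩-tight : (x : Vector ℝ m) (P : Subset m) →
  (∀ e → e ∈ P → x e ≤ᵣ 1ᵣ) → fromℤ (+ ∣ P ∣) ≤ᵣ x ⟨ P ⟩ →
  ∀ e → e ∈ P → 1ᵣ ≤ᵣ x e
⟨⟩-tight x (true ∷ P) x≤1 ∣P∣≤x zero here =
  +ᵣ-cancelʳ-≤ 1ᵣ (x zero) (fromℤ (+ ∣ P ∣)) (begin
    1ᵣ +ᵣ fromℤ (+ ∣ P ∣)       ≈⟨ ≐-sym (fromℤ-homo-+ (+ 1) (+ ∣ P ∣)) ⟩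
    fromℤ (+ ∣ true ∷ P ∣)      ≲⟨ ∣P∣≤x ⟩
    x zero +ᵣ (x ∘ suc) ⟨ P ⟩   ≲⟨ +ᵣ-mono-≤ {x zero} {x zero} {(x ∘ suc) ⟨ P ⟩} {fromℤ (+ ∣ P ∣)}
                                     (≤ᵣ-refl (x zero))
                                     (⟨⟩≤∣∣ (x ∘ suc) P (λ e → x≤1 (suc e) ∘ there)) ⟩
    x zero +ᵣ fromℤ (+ ∣ P ∣)   ∎)
-- The head contributes at most `ι p` to the sum and exactly `ι p` to the cardinality, so cancelling
-- it restores the hypothesis for the tail.
⟨⟩-tight x (p ∷ P) x≤1 ∣P∣≤x (suc e) (there e∈P) =
  ⟨⟩-tight (x ∘ suc) P (λ e → x≤1 (suc e) ∘ there)
    (+ᵣ-cancelˡ-≤ (fromℤ (+ ι p)) (fromℤ (+ ∣ P ∣)) ((x ∘ suc) ⟨ P ⟩) (begin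
      fromℤ (+ ι p) +ᵣ fromℤ (+ ∣ P ∣)
        ≈⟨ ≐-sym (fromℤ-homo-+ (+ ι p) (+ ∣ P ∣)) ⟩
      fromℤ (+ (ι p ℕ.+ ∣ P ∣))
        ≈⟨ ≡⇒≐ (cong (fromℤ ∘ +_) (sym (∣∷∣ p P))) ⟩
      fromℤ (+ ∣ p ∷ P ∣)
        ≲⟨ ∣P∣≤x ⟩
      (if p then x zero else 0ᵣ) +ᵣ (x ∘ suc) ⟨ P ⟩
        ≲⟨ +ᵣ-mono-≤ {if p then x zero else 0ᵣ} {fromℤ (+ ι p)}
             {(x ∘ suc) ⟨ P ⟩} {(x ∘ suc) ⟨ P ⟩}
             (head p (x≤1 zero)) (≤ᵣ-refl ((x ∘ suc) ⟨ P ⟩)) ⟩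
      fromℤ (+ ι p) +ᵣ (x ∘ suc) ⟨ P ⟩ ∎))
    e e∈P
  where
  head : ∀ p → (zero ∈ p ∷ P → x zero ≤ᵣ 1ᵣ) → (if p then x zero else 0ᵣ) ≤ᵣ fromℤ (+ ι p)
  head true  x≤1 = x≤1 here
  head false _   = ≤ᵣ-refl 0ᵣ

-- Set identities: after membership is computed, each is a finite statement about truth values.

-- Nested uses decide a statement about several truth values by evaluation; `toWitness` then
-- extracts its proof.
∀ᵇ? : ∀ {P : Bool → Set} → (∀ b → Dec (P b)) → Dec (∀ b → P b)
∀ᵇ? P? = map′ (λ { (p , q) true → p ; (p , q) false → q }) (λ h → h true , h false)
  (P? true ×-dec P? false)

lookup-∩ : ∀ (P Q : Subset n) i → lookup (P ∩ Q) i ≡ lookup P i ∧ lookup Q i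
lookup-∩ P Q i = lookup-zipWith _∧_ i P Q

lookup-∪ : ∀ (P Q : Subset n) i → lookup (P ∪ Q) i ≡ lookup P i ∨ lookup Q i
lookup-∪ P Q i = lookup-zipWith _∨_ i P Q

lookup-─ : ∀ (P Q : Subset n) i → lookup (P ─ Q) i ≡ lookup P i ∧ not (lookup Q i)
lookup-─ (p ∷ P) (true  ∷ Q) zero    = sym (Bool.∧-zeroʳ p)
lookup-─ (p ∷ P) (false ∷ Q) zero    = sym (Bool.∧-identityʳ p)
lookup-─ (p ∷ P) (true  ∷ Q) (suc i) = lookup-─ P Q i
lookup-─ (p ∷ P) (false ∷ Q) (suc i) = lookup-─ P Q i

lookup-⊥ : (i : Fin n) → lookup ⊥ i ≡ false
lookup-⊥ i = lookup-replicate i false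

lookup-δ : ∀ (D : Graph n m) S e →
  lookup (δ D S) e ≡ lookup (E D) e ∧ (lookup S (end₁ D e) xor lookup S (end₂ D e))
lookup-δ D S e = trans (lookup-∩ (E D) _ e) (cong (lookup (E D) e ∧_) (lookup∘tabulate _ e))

lookup-within : ∀ (D : Graph n m) Z S e →
  lookup (within D Z S) e ≡ lookup Z e ∧ (lookup S (end₁ D e) ∧ lookup S (end₂ D e))
lookup-within D Z S e = trans (lookup-∩ Z _ e) (cong (lookup Z e ∧_) (lookup∘tabulate _ e))

lookup-ext : {P Q : Subset n} → (∀ i → lookup P i ≡ lookup Q i) → P ≡ Q
lookup-ext {P = P} {Q} p =
  trans (sym (tabulate∘lookup P)) (trans (tabulate-cong p) (tabulate∘lookup Q))

⊆⇒lookup : {P Q : Subset n} → P ⊆ Q → ∀ i → lookup P i ≡ true → lookup Q i ≡ true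
⊆⇒lookup {P = P} P⊆Q i p = []=⇒lookup (P⊆Q (lookup⇒[]= i P p))

p⊆q⇒p∩q≡p : {P Q : Subset n} → P ⊆ Q → P ∩ Q ≡ P
p⊆q⇒p∩q≡p {P = P} {Q} P⊆Q = ⊆-antisym (p∩q⊆p P Q) λ i∈P → x∈p∩q⁺ (i∈P , P⊆Q i∈P)

∪-⊆ : {P Q R : Subset n} → P ⊆ R → Q ⊆ R → P ∪ Q ⊆ R
∪-⊆ {P = P} {Q} P⊆R Q⊆R i∈P∪Q with x∈p∪q⁻ P Q i∈P∪Q
... | inj₁ i∈P = P⊆R i∈P
... | inj₂ i∈Q = Q⊆R i∈Q

v─[v─b]≡b : {B U : Subset n} → B ⊆ U → U ─ (U ─ B) ≡ B
v─[v─b]≡b {B = B} {U} B⊆U = lookup-ext go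
  where
  go : ∀ i → lookup (U ─ (U ─ B)) i ≡ lookup B i
  go i rewrite lookup-─ U (U ─ B) i | lookup-─ U B i = toWitness
    {a? = ∀ᵇ? λ u → ∀ᵇ? λ b → (b Bool.≟ true →-dec u Bool.≟ true) →-dec
          (u ∧ not (u ∧ not b) Bool.≟ b)}
    _ (lookup U i) (lookup B i) (⊆⇒lookup B⊆U i)

t∩[v─b]≡⊥ : {T B : Subset n} (U : Subset n) → T ⊆ B → T ∩ (U ─ B) ≡ ⊥
t∩[v─b]≡⊥ {T = T} {B} U T⊆B = lookup-ext go
  where
  go : ∀ i → lookup (T ∩ (U ─ B)) i ≡ lookup ⊥ i
  go i rewrite lookup-∩ T (U ─ B) i | lookup-─ U B i | lookup-⊥ i = toWitness
    {a? = ∀ᵇ? λ t → ∀ᵇ? λ u → ∀ᵇ? λ b → (t Bool.≟ true →-dec b Bool.≟ true) →-dec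
          (t ∧ (u ∧ not b) Bool.≟ false)}
    _ (lookup T i) (lookup U i) (lookup B i) (⊆⇒lookup T⊆B i)

[t∪v─b]∩b≡t : {T B : Subset n} (U : Subset n) → T ⊆ B → (T ∪ (U ─ B)) ∩ B ≡ T
[t∪v─b]∩b≡t {T = T} {B} U T⊆B = lookup-ext go
  where
  go : ∀ i → lookup ((T ∪ (U ─ B)) ∩ B) i ≡ lookup T i
  go i rewrite lookup-∩ (T ∪ (U ─ B)) B i | lookup-∪ T (U ─ B) i | lookup-─ U B i = toWitness
    {a? = ∀ᵇ? λ t → ∀ᵇ? λ u → ∀ᵇ? λ b → (t Bool.≟ true →-dec b Bool.≟ true) →-dec
          ((t ∨ (u ∧ not b)) ∧ b Bool.≟ t)}
    _ (lookup T i) (lookup U i) (lookup B i) (⊆⇒lookup T⊆B i)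

[t∪b]∩b≡b : (T B : Subset n) → (T ∪ B) ∩ B ≡ B
[t∪b]∩b≡b T B = ⊆-antisym (p∩q⊆q (T ∪ B) B) λ i∈B → x∈p∩q⁺ (q⊆p∪q T B i∈B , i∈B)

s∪a≡[s∩[v─a]]∪a : {S U : Subset n} (A : Subset n) → S ⊆ U → S ∪ A ≡ (S ∩ (U ─ A)) ∪ A
s∪a≡[s∩[v─a]]∪a {S = S} {U} A S⊆U = lookup-ext go
  where
  go : ∀ i → lookup (S ∪ A) i ≡ lookup ((S ∩ (U ─ A)) ∪ A) i
  go i rewrite lookup-∪ (S ∩ (U ─ A)) A i | lookup-∪ S A i
             | lookup-∩ S (U ─ A) i | lookup-─ U A i = toWitness
    {a? = ∀ᵇ? λ s → ∀ᵇ? λ u → ∀ᵇ? λ a → (s Bool.≟ true →-dec u Bool.≟ true) →-dec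
          (s ∨ a Bool.≟ (s ∧ (u ∧ not a)) ∨ a)}
    _ (lookup S i) (lookup U i) (lookup A i) (⊆⇒lookup S⊆U i)

s─a≡s∩[v─a] : {S U : Subset n} (A : Subset n) → S ⊆ U → S ─ A ≡ S ∩ (U ─ A)
s─a≡s∩[v─a] {S = S} {U} A S⊆U = lookup-ext go
  where
  go : ∀ i → lookup (S ─ A) i ≡ lookup (S ∩ (U ─ A)) i
  go i rewrite lookup-─ S A i | lookup-∩ S (U ─ A) i | lookup-─ U A i = toWitness
    {a? = ∀ᵇ? λ s → ∀ᵇ? λ u → ∀ᵇ? λ a → (s Bool.≟ true →-dec u Bool.≟ true) →-dec
          (s ∧ not a Bool.≟ s ∧ (u ∧ not a))}
    _ (lookup S i) (lookup U i) (lookup A i) (⊆⇒lookup S⊆U i)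

v─[a─s]≡[s∩a]∪[v─a] : {A U : Subset n} (S : Subset n) → A ⊆ U →
  U ─ (A ─ S) ≡ (S ∩ A) ∪ (U ─ A)
v─[a─s]≡[s∩a]∪[v─a] {A = A} {U} S A⊆U = lookup-ext go
  where
  go : ∀ i → lookup (U ─ (A ─ S)) i ≡ lookup ((S ∩ A) ∪ (U ─ A)) i
  go i rewrite lookup-─ U (A ─ S) i | lookup-─ A S i | lookup-∪ (S ∩ A) (U ─ A) i
             | lookup-∩ S A i | lookup-─ U A i = toWitness
    {a? = ∀ᵇ? λ a → ∀ᵇ? λ u → ∀ᵇ? λ s → (a Bool.≟ true →-dec u Bool.≟ true) →-dec
          (u ∧ not (a ∧ not s) Bool.≟ (s ∧ a) ∨ (u ∧ not a))}
    _ (lookup A i) (lookup U i) (lookup S i) (⊆⇒lookup A⊆U i)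

-- Cuts of a graph and of its induced subgraphs

∈E⇒ends∈V : ∀ (G : Graph n m) e → lookup (E G) e ≡ true →
  lookup (V G) (end₁ G e) ∧ lookup (V G) (end₂ G e) ≡ true
∈E⇒ends∈V G e e∈E =
  let v , w = ends∈V G (lookup⇒[]= e (E G) e∈E) in cong₂ _∧_ ([]=⇒lookup v) ([]=⇒lookup w)

δ-⊥ : (D : Graph n m) → δ D ⊥ ≡ ⊥
δ-⊥ D = lookup-ext go
  where
  go : ∀ e → lookup (δ D ⊥) e ≡ lookup ⊥ e
  go e rewrite lookup-δ D ⊥ e | lookup-⊥ e | lookup-⊥ (end₁ D e) | lookup-⊥ (end₂ D e) =
    Bool.∧-zeroʳ (lookup (E D) e)

δ-induced-self : (G : Graph n m) (B : Subset n) → δ (induced G B) B ≡ ⊥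
δ-induced-self G B = lookup-ext go
  where
  go : ∀ e → lookup (δ (induced G B) B) e ≡ lookup ⊥ e
  go e rewrite lookup-δ (induced G B) B e | lookup-within G (E G) B e | lookup-⊥ e = toWitness
    {a? = ∀ᵇ? λ e → ∀ᵇ? λ b → ∀ᵇ? λ c → (e ∧ (b ∧ c)) ∧ (b xor c) Bool.≟ false}
    _ (lookup (E G) e) (lookup B (end₁ G e)) (lookup B (end₂ G e))

-- Both ends of an edge lie in `V G`, so complementing flips both memberships and preserves their
-- xor.
δ-complement : (G : Graph n m) (S : Subset n) → δ G (V G ─ S) ≡ δ G S
δ-complement G S = lookup-ext go
  where
  go : ∀ e → lookup (δ G (V G ─ S)) e ≡ lookup (δ G S) e
  go e rewrite lookup-δ G (V G ─ S) e | lookup-δ G S e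
             | lookup-─ (V G) S (end₁ G e) | lookup-─ (V G) S (end₂ G e) = toWitness
    {a? = ∀ᵇ? λ e → ∀ᵇ? λ v → ∀ᵇ? λ w → ∀ᵇ? λ s → ∀ᵇ? λ t →
          (e Bool.≟ true →-dec v ∧ w Bool.≟ true) →-dec
          (e ∧ ((v ∧ not s) xor (w ∧ not t)) Bool.≟ e ∧ (s xor t))}
    _ (lookup (E G) e) (lookup (V G) (end₁ G e)) (lookup (V G) (end₂ G e))
    (lookup S (end₁ G e)) (lookup S (end₂ G e)) (∈E⇒ends∈V G e)

δ-submodular : ∀ (G : Graph n m) S A →
  ∣ δ G (S ∩ A) ∣ ℕ.+ ∣ δ G (S ∪ A) ∣ ℕ.≤ ∣ δ G S ∣ ℕ.+ ∣ δ G A ∣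
δ-submodular G S A = ∣∣-mono₂ (δ G (S ∩ A)) (δ G (S ∪ A)) (δ G S) (δ G A) go
  where
  go : ∀ e → ι (lookup (δ G (S ∩ A)) e) ℕ.+ ι (lookup (δ G (S ∪ A)) e) ℕ.≤
             ι (lookup (δ G S) e) ℕ.+ ι (lookup (δ G A) e)
  go e rewrite lookup-δ G (S ∩ A) e | lookup-δ G (S ∪ A) e | lookup-δ G S e | lookup-δ G A e
             | lookup-∩ S A (end₁ G e) | lookup-∩ S A (end₂ G e)
             | lookup-∪ S A (end₁ G e) | lookup-∪ S A (end₂ G e) = toWitness
    {a? = ∀ᵇ? λ e → ∀ᵇ? λ s → ∀ᵇ? λ t → ∀ᵇ? λ a → ∀ᵇ? λ b →
          ι (e ∧ ((s ∧ a) xor (t ∧ b))) ℕ.+ ι (e ∧ ((s ∨ a) xor (t ∨ b))) ℕ.≤?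
          ι (e ∧ (s xor t)) ℕ.+ ι (e ∧ (a xor b))}
    _ (lookup (E G) e) (lookup S (end₁ G e)) (lookup S (end₂ G e))
    (lookup A (end₁ G e)) (lookup A (end₂ G e))

-- The counterpart of the second alternative of weak supermodularity, as `δ-submodular` is of the
-- first.
δ-posimodular : ∀ (G : Graph n m) S A →
  ∣ δ G (S ─ A) ∣ ℕ.+ ∣ δ G (A ─ S) ∣ ℕ.≤ ∣ δ G S ∣ ℕ.+ ∣ δ G A ∣
δ-posimodular G S A = ∣∣-mono₂ (δ G (S ─ A)) (δ G (A ─ S)) (δ G S) (δ G A) go
  where
  go : ∀ e → ι (lookup (δ G (S ─ A)) e) ℕ.+ ι (lookup (δ G (A ─ S)) e) ℕ.≤
             ι (lookup (δ G S) e) ℕ.+ ι (lookup (δ G A) e)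
  go e rewrite lookup-δ G (S ─ A) e | lookup-δ G (A ─ S) e | lookup-δ G S e | lookup-δ G A e
             | lookup-─ S A (end₁ G e) | lookup-─ S A (end₂ G e)
             | lookup-─ A S (end₁ G e) | lookup-─ A S (end₂ G e) = toWitness
    {a? = ∀ᵇ? λ e → ∀ᵇ? λ s → ∀ᵇ? λ t → ∀ᵇ? λ a → ∀ᵇ? λ b →
          ι (e ∧ ((s ∧ not a) xor (t ∧ not b))) ℕ.+ ι (e ∧ ((a ∧ not s) xor (b ∧ not t))) ℕ.≤?
          ι (e ∧ (s xor t)) ℕ.+ ι (e ∧ (a xor b))}
    _ (lookup (E G) e) (lookup S (end₁ G e)) (lookup S (end₂ G e))
    (lookup A (end₁ G e)) (lookup A (end₂ G e))

-- Serves to collect the bound `x e ≤ 1` on all of `E G`: from saturation on the cut, and from the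
-- two induced subgraphs elsewhere.
E-split : ∀ (G : Graph n m) B {e} → e ∈ E G →
  e ∈ δ G B ⊎ e ∈ E (induced G B) ⊎ e ∈ E (induced G (V G ─ B))
E-split G B {e} e∈E with lookup (δ G B) e in eq₁ | lookup (E (induced G B)) e in eq₂
... | true  | _     = inj₁ (lookup⇒[]= e _ eq₁)
... | false | true  = inj₂ (inj₁ (lookup⇒[]= e _ eq₂))
... | false | false = inj₂ (inj₂ (lookup⇒[]= e _ (go eq₁ eq₂ ([]=⇒lookup e∈E))))
  where
  go : lookup (δ G B) e ≡ false → lookup (E (induced G B)) e ≡ false → lookup (E G) e ≡ true →
       lookup (E (induced G (V G ─ B))) e ≡ true
  go rewrite lookup-δ G B e | lookup-within G (E G) B e | lookup-within G (E G) (V G ─ B) e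
           | lookup-─ (V G) B (end₁ G e) | lookup-─ (V G) B (end₂ G e) = toWitness
    {a? = ∀ᵇ? λ e → ∀ᵇ? λ v → ∀ᵇ? λ w → ∀ᵇ? λ b → ∀ᵇ? λ c →
          (e Bool.≟ true →-dec v ∧ w Bool.≟ true) →-dec
          (e ∧ (b xor c) Bool.≟ false →-dec e ∧ (b ∧ c) Bool.≟ false →-dec
           e Bool.≟ true →-dec e ∧ ((v ∧ not b) ∧ (w ∧ not c)) Bool.≟ true)}
    _ (lookup (E G) e) (lookup (V G) (end₁ G e)) (lookup (V G) (end₂ G e))
    (lookup B (end₁ G e)) (lookup B (end₂ G e)) (∈E⇒ends∈V G e)

-- An edge lying on one side of `B` sees only the trace of `S` on that side; every other edge of
-- `δ G S` crosses `B`.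
δ-split : ∀ (G : Graph n m) B S →
  Splits (δ G S) (δ (induced G B) (S ∩ B)) (δ (induced G (V G ─ B)) (S ∩ (V G ─ B)))
         (δ[ δ G B ] G S)
δ-split G B S e
  rewrite lookup-∩ (δ G S) (δ G B) e | lookup-δ G S e | lookup-δ G B e
        | lookup-δ (induced G B) (S ∩ B) e | lookup-within G (E G) B e
        | lookup-δ (induced G (V G ─ B)) (S ∩ (V G ─ B)) e | lookup-within G (E G) (V G ─ B) e
        | lookup-∩ S B (end₁ G e) | lookup-∩ S B (end₂ G e)
        | lookup-∩ S (V G ─ B) (end₁ G e) | lookup-∩ S (V G ─ B) (end₂ G e)
        | lookup-─ (V G) B (end₁ G e) | lookup-─ (V G) B (end₂ G e) = toWitness
    {a? = ∀ᵇ? λ e → ∀ᵇ? λ v → ∀ᵇ? λ w → ∀ᵇ? λ b → ∀ᵇ? λ c → ∀ᵇ? λ s → ∀ᵇ? λ t →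
          (e Bool.≟ true →-dec v ∧ w Bool.≟ true) →-dec
          (ι (e ∧ (s xor t)) ℕ.≟
           ι ((e ∧ (b ∧ c)) ∧ ((s ∧ b) xor (t ∧ c))) ℕ.+
           ι ((e ∧ ((v ∧ not b) ∧ (w ∧ not c))) ∧ ((s ∧ (v ∧ not b)) xor (t ∧ (w ∧ not c)))) ℕ.+
           ι ((e ∧ (s xor t)) ∧ (e ∧ (b xor c))))}
    _ (lookup (E G) e) (lookup (V G) (end₁ G e)) (lookup (V G) (end₂ G e))
    (lookup B (end₁ G e)) (lookup B (end₂ G e)) (lookup S (end₁ G e)) (lookup S (end₂ G e))
    (∈E⇒ends∈V G e)

-- Deficiency and restriction

+ᶻ-cancelʳ-≤ : ∀ i j k → i ℤ.+ k ℤ.≤ j ℤ.+ k → i ℤ.≤ j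
+ᶻ-cancelʳ-≤ i j k i+k≤j+k =
  subst₂ ℤ._≤_ (cancel i k) (cancel j k) (ℤ.+-monoˡ-≤ (ℤ.- k) i+k≤j+k)
  where
  cancel : ∀ i k → (i ℤ.+ k) ℤ.- k ≡ i
  cancel = ℤ-Solver.solve-∀

-- Adding a cut size back passes from deficiencies or reduced demands to the minima that occur in
-- cut constraints.
⊓-shift : ∀ i j k → (i ℤ.- k) ⊓ j ℤ.+ k ≡ i ⊓ (j ℤ.+ k)
⊓-shift i j k = trans
  (ℤ.mono-≤-distrib-⊓ {f = ℤ._+ k} (ℤ.+-monoˡ-≤ k) (i ℤ.- k) j)
  (cong (_⊓ (j ℤ.+ k)) (cancel i k))
  where
  cancel : ∀ i k → (i ℤ.- k) ℤ.+ k ≡ i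
  cancel = ℤ-Solver.solve-∀

-- Depending on which arguments attain the two minima, the right side is `p + q`, `p`, `q` or 0, and
-- each of these is an upper bound of `u ⊓ 0`.
⊓0-subadditive : ∀ {u p q} → u ℤ.≤ p → u ℤ.≤ q → u ℤ.≤ p ℤ.+ q → u ⊓ 0ℤ ℤ.≤ p ⊓ 0ℤ ℤ.+ q ⊓ 0ℤ
⊓0-subadditive {u} {p} {q} u≤p u≤q u≤p+q with ℤ.⊓-sel p 0ℤ | ℤ.⊓-sel q 0ℤ
... | inj₁ p⊓0 | inj₁ q⊓0 rewrite p⊓0 | q⊓0 = ℤ.i≤j⇒i⊓k≤j 0ℤ u≤p+q
... | inj₁ p⊓0 | inj₂ q⊓0 rewrite p⊓0 | q⊓0 | ℤ.+-identityʳ p = ℤ.i≤j⇒i⊓k≤j 0ℤ u≤p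
... | inj₂ p⊓0 | inj₁ q⊓0 rewrite p⊓0 | q⊓0 | ℤ.+-identityˡ q = ℤ.i≤j⇒i⊓k≤j 0ℤ u≤q
... | inj₂ p⊓0 | inj₂ q⊓0 rewrite p⊓0 | q⊓0 = ℤ.i⊓j≤j u 0ℤ

subtract-≤ : ∀ a b c d {p q r s} → a ℤ.+ b ℤ.≤ c ℤ.+ d → p ℕ.+ q ℕ.≤ r ℕ.+ s →
  (a ℤ.- + r) ℤ.+ (b ℤ.- + s) ℤ.≤ (c ℤ.- + p) ℤ.+ (d ℤ.- + q)
subtract-≤ a b c d {p} {q} {r} {s} a+b≤c+d p+q≤r+s =
  subst₂ ℤ._≤_ (regroup a b (+ r) (+ s)) (regroup c d (+ p) (+ q))
    (ℤ.+-mono-≤ a+b≤c+d (ℤ.neg-mono-≤ (ℤ.+≤+ p+q≤r+s)))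
  where
  regroup : ∀ a b p q → (a ℤ.+ b) ℤ.- (p ℤ.+ q) ≡ (a ℤ.- p) ℤ.+ (b ℤ.- q)
  regroup = ℤ-Solver.solve-∀

deficiency-⊥ : ∀ (D : Graph n m) h S → h S ≡ 0ℤ → δ D S ≡ ⊥ → deficiency D h S ≡ 0ℤ
deficiency-⊥ {m = m} D h S hS≡0 δ≡⊥ rewrite hS≡0 | δ≡⊥ | ∣⊥∣≡0 m = refl

-- The two sets whose deficiencies are compared in the definition of the restriction to B at T.
Extension : Graph n m → (B T P : Subset n) → Set
Extension G B T P = P ≡ T ⊎ P ≡ T ∪ (V G ─ B)

module _ (G : Graph n m) {B T : Subset n} (B⊆V : B ⊆ V G) (T⊆B : T ⊆ B) where

  extension-⊆V : ∀ {P} → Extension G B T P → P ⊆ V G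
  extension-⊆V (inj₁ refl) = B⊆V ∘ T⊆B
  extension-⊆V (inj₂ refl) = ∪-⊆ (B⊆V ∘ T⊆B) (p─q⊆p (V G) B)

  -- On the side of the complement of `B`, an extension of `T` contains either nothing or
  -- everything, so the induced subgraph there contributes no cut edge; this is the `⊥` in the
  -- middle.
  extension-split : ∀ {P} → Extension G B T P →
    Splits (δ G P) (δ (induced G B) T) ⊥ (δ[ δ G B ] G P)
  extension-split (inj₁ refl) = subst₂ (λ Q R → Splits (δ G T) Q R (δ[ δ G B ] G T))
    (cong (δ (induced G B)) (p⊆q⇒p∩q≡p T⊆B))
    (trans (cong (δ (induced G (V G ─ B))) (t∩[v─b]≡⊥ (V G) T⊆B)) (δ-⊥ (induced G (V G ─ B))))
    (δ-split G B T)
  extension-split (inj₂ refl) = subst₂ (λ Q R → Splits (δ G P) Q R (δ[ δ G B ] G P))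
    (cong (δ (induced G B)) ([t∪v─b]∩b≡t (V G) T⊆B))
    (trans (cong (δ (induced G (V G ─ B))) ([t∪b]∩b≡b T (V G ─ B)))
           (δ-induced-self G (V G ─ B)))
    (δ-split G B P)
    where P = T ∪ (V G ─ B)

  ∣δ-extension∣ : ∀ {P} → Extension G B T P →
    ∣ δ G P ∣ ≡ ∣ δ (induced G B) T ∣ ℕ.+ ∣ δ[ δ G B ] G P ∣
  ∣δ-extension∣ {P} ext = trans
    (∣∣-split (δ G P) (δ (induced G B) T) ⊥ (δ[ δ G B ] G P) (extension-split ext))
    (cong (ℕ._+ ∣ δ[ δ G B ] G P ∣)
      (trans (cong (∣ δ (induced G B) T ∣ ℕ.+_) (∣⊥∣≡0 m)) (ℕ.+-identityʳ _)))

module _ (G : Graph n m) (f : SetFunction n) where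

  -- The demand that remains at `P` once all crossing edges are bought; the restriction takes the
  -- larger of its values at the two extensions.
  reduced : (B P : Subset n) → ℤ
  reduced B P = f P ℤ.- + ∣ δ[ δ G B ] G P ∣

  -- At the two trivial sets the default value 0 comes with an empty induced cut, so the constraint
  -- there reads `0 ≤ 0`.
  restriction-cases : ∀ B T →
    (restriction G f B T ≡ 0ℤ × δ (induced G B) T ≡ ⊥) ⊎
    (restriction G f B T ≡ reduced B T ⊔ reduced B (T ∪ (V G ─ B)))
  restriction-cases B T with ≡-dec Bool._≟_ T ⊥ | ≡-dec Bool._≟_ T B
  ... | yes refl | _        = inj₁ (refl , δ-⊥ (induced G B))
  ... | no _     | yes refl = inj₁ (refl , δ-induced-self G B)
  ... | no _     | no _     = inj₂ refl

  -- The cut of an extension `P` consists of the induced cut at `T` and edges of `δ G B`. As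
  -- `reduced` subtracts the latter already, subtracting the former gives exactly the deficiency of
  -- `P`.
  restriction-deficiency : ∀ {B T} → B ⊆ V G → T ⊆ B →
    deficiency (induced G B) (restriction G f B) T ≡ 0ℤ ⊎
    (∀ P → Extension G B T P →
       deficiency G f P ℤ.≤ deficiency (induced G B) (restriction G f B) T)
  restriction-deficiency {B} {T} B⊆V T⊆B with restriction-cases B T
  ... | inj₁ (r≡0 , δ≡⊥) = inj₁ (deficiency-⊥ (induced G B) (restriction G f B) T r≡0 δ≡⊥)
  ... | inj₂ r≡max = inj₂ λ P ext →
    subst (ℤ._≤ deficiency (induced G B) (restriction G f B) T) (sym (deficiency-reduced ext))
      (ℤ.+-monoˡ-≤ (ℤ.- + ∣ δ (induced G B) T ∣)
        (subst (reduced B P ℤ.≤_) (sym r≡max) (reduced≤max ext)))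
    where
    reduced≤max : ∀ {P} → Extension G B T P →
      reduced B P ℤ.≤ reduced B T ⊔ reduced B (T ∪ (V G ─ B))
    reduced≤max (inj₁ refl) = ℤ.i≤i⊔j (reduced B T) (reduced B (T ∪ (V G ─ B)))
    reduced≤max (inj₂ refl) = ℤ.i≤j⊔i (reduced B T) (reduced B (T ∪ (V G ─ B)))
    deficiency-reduced : ∀ {P} → Extension G B T P →
      deficiency G f P ≡ reduced B P ℤ.- + ∣ δ (induced G B) T ∣
    deficiency-reduced {P} ext = trans
      (cong (λ k → f P ℤ.- + k) (∣δ-extension∣ G B⊆V T⊆B ext))
      (regroup (f P) (+ ∣ δ (induced G B) T ∣) (+ ∣ δ[ δ G B ] G P ∣))
      where
      regroup : ∀ a b c → a ℤ.- (b ℤ.+ c) ≡ (a ℤ.- c) ℤ.- b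
      regroup = ℤ-Solver.solve-∀

  -- Uncrossing with a maximum-deficiency cut

  deficiency-complement : Symmetric (V G) f → ∀ {S} → S ⊆ V G →
    deficiency G f (V G ─ S) ≡ deficiency G f S
  deficiency-complement f-sym {S} S⊆V =
    cong₂ (λ a P → a ℤ.- + ∣ P ∣) (sym (f-sym S S⊆V)) (δ-complement G S)

  -- Cut sizes are both submodular and posimodular, so whichever alternative attains the maximum for
  -- `f` survives their subtraction.
  deficiency-weaklySupermodular : WeaklySupermodular (V G) f →
    ∀ {S A} → S ⊆ V G → A ⊆ V G →
    (deficiency G f S ℤ.+ deficiency G f A ℤ.≤
     deficiency G f (S ∩ A) ℤ.+ deficiency G f (S ∪ A)) ⊎
    (deficiency G f S ℤ.+ deficiency G f A ℤ.≤
     deficiency G f (S ─ A) ℤ.+ deficiency G f (A ─ S))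
  deficiency-weaklySupermodular f-wsm {S} {A} S⊆V A⊆V
    with ℤ.⊔-sel (f (S ∩ A) ℤ.+ f (S ∪ A)) (f (S ─ A) ℤ.+ f (A ─ S)) | f-wsm S A S⊆V A⊆V
  ... | inj₁ max≡ | fS+fA≤ = inj₁ (subtract-≤ (f S) (f A) (f (S ∩ A)) (f (S ∪ A))
    (subst (f S ℤ.+ f A ℤ.≤_) max≡ fS+fA≤) (δ-submodular G S A))
  ... | inj₂ max≡ | fS+fA≤ = inj₂ (subtract-≤ (f S) (f A) (f (S ─ A)) (f (A ─ S))
    (subst (f S ℤ.+ f A ℤ.≤_) max≡ fS+fA≤) (δ-posimodular G S A))

  -- Complementing A ─ S turns the second alternative of weak supermodularity into a bound by
  -- extensions as well.
  uncross : WeaklySupermodular (V G) f → Symmetric (V G) f →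
    ∀ {S A} → S ⊆ V G → A ⊆ V G →
    ∃[ P ] ∃[ Q ] Extension G A (S ∩ A) P × Extension G (V G ─ A) (S ∩ (V G ─ A)) Q ×
      deficiency G f S ℤ.+ deficiency G f A ℤ.≤ deficiency G f P ℤ.+ deficiency G f Q
  uncross f-wsm f-sym {S} {A} S⊆V A⊆V with deficiency-weaklySupermodular f-wsm S⊆V A⊆V
  ... | inj₁ dS+dA≤ = S ∩ A , S ∪ A , inj₁ refl
    , inj₂ (trans (s∪a≡[s∩[v─a]]∪a A S⊆V)
                  (cong ((S ∩ (V G ─ A)) ∪_) (sym (v─[v─b]≡b A⊆V))))
    , dS+dA≤
  ... | inj₂ dS+dA≤ = V G ─ (A ─ S) , S ─ A , inj₂ (v─[a─s]≡[s∩a]∪[v─a] S A⊆V)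
    , inj₁ (s─a≡s∩[v─a] A S⊆V)
    , subst (deficiency G f S ℤ.+ deficiency G f A ℤ.≤_)
        (trans (ℤ.+-comm (deficiency G f (S ─ A)) (deficiency G f (A ─ S)))
               (cong (ℤ._+ deficiency G f (S ─ A))
                 (sym (deficiency-complement f-sym (A⊆V ∘ p─q⊆p A S)))))
        dS+dA≤

  -- Adding the size of `δ G S`, which is `a + b + c`, to both sides of the deficiency bound
  -- `u ⊓ 0 ≤ p ⊓ 0 + q ⊓ 0` turns each minimum with 0 into a minimum with a cut size.
  restrictions-cover : WeaklySupermodular (V G) f → Symmetric (V G) f →
    ∀ {A} → MaximumDeficiencyCut G f A → 0ℤ ℤ.≤ deficiency G f A → ∀ {S} → S ⊆ V G →
    let A̅ = V G ─ A
        a = + ∣ δ (induced G A) (S ∩ A) ∣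
        b = + ∣ δ (induced G A̅) (S ∩ A̅) ∣
        c = + ∣ δ[ δ G A ] G S ∣
    in f S ⊓ + ∣ δ G S ∣ ℤ.≤
       (restriction G f A (S ∩ A) ⊓ a ℤ.+ restriction G f A̅ (S ∩ A̅) ⊓ b) ℤ.+ c
  restrictions-cover f-wsm f-sym {A} (A⊆V , max) 0≤dA {S} S⊆V
    with uncross f-wsm f-sym S⊆V A⊆V
  ... | P , Q , extP , extQ , dS+dA≤dP+dQ = subst₂ ℤ._≤_
    (⊓-relative (f S) (+ ∣ δ G S ∣))
    (trans (cong (λ k → (p ⊓ 0ℤ ℤ.+ q ⊓ 0ℤ) ℤ.+ + k) ∣δS∣)
      (trans (regroup (p ⊓ 0ℤ) (q ⊓ 0ℤ) a b c)
        (cong (ℤ._+ c) (cong₂ ℤ._+_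
          (⊓-relative (restriction G f A (S ∩ A)) a)
          (⊓-relative (restriction G f A̅ (S ∩ A̅)) b)))))
    (ℤ.+-monoˡ-≤ (+ ∣ δ G S ∣) (bound
      (restriction-deficiency A⊆V (p∩q⊆q S A))
      (restriction-deficiency (p─q⊆p (V G) A) (p∩q⊆q S A̅))))
    where
    A̅ = V G ─ A
    a = + ∣ δ (induced G A) (S ∩ A) ∣
    b = + ∣ δ (induced G A̅) (S ∩ A̅) ∣
    c = + ∣ δ[ δ G A ] G S ∣
    p = deficiency (induced G A) (restriction G f A) (S ∩ A)
    q = deficiency (induced G A̅) (restriction G f A̅) (S ∩ A̅)
    u = deficiency G f S
    dA = deficiency G f A
    dP = deficiency G f P
    dQ = deficiency G f Q

    ∣δS∣ : ∣ δ G S ∣ ≡ ∣ δ (induced G A) (S ∩ A) ∣ ℕ.+ ∣ δ (induced G A̅) (S ∩ A̅) ∣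
                       ℕ.+ ∣ δ[ δ G A ] G S ∣
    ∣δS∣ = ∣∣-split (δ G S) (δ (induced G A) (S ∩ A)) (δ (induced G A̅) (S ∩ A̅))
             (δ[ δ G A ] G S) (δ-split G A S)

    regroup : ∀ p q a b c → (p ℤ.+ q) ℤ.+ (a ℤ.+ b ℤ.+ c) ≡ ((p ℤ.+ a) ℤ.+ (q ℤ.+ b)) ℤ.+ c
    regroup = ℤ-Solver.solve-∀

    ⊓-relative : ∀ i j → (i ℤ.- j) ⊓ 0ℤ ℤ.+ j ≡ i ⊓ j
    ⊓-relative i j = trans (⊓-shift i 0ℤ j) (cong (i ⊓_) (ℤ.+-identityˡ j))

    dP≤dA : dP ℤ.≤ dA
    dP≤dA = max P (extension-⊆V G A⊆V (p∩q⊆q S A) extP)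

    dQ≤dA : dQ ℤ.≤ dA
    dQ≤dA = max Q (extension-⊆V G (p─q⊆p (V G) A) (p∩q⊆q S A̅) extQ)

    -- Maximality bounds the deficiency of the other extension by `dA`, which then cancels against
    -- the `dA` on the left of the uncrossing inequality.
    u≤dP : u ℤ.≤ dP
    u≤dP = +ᶻ-cancelʳ-≤ u dP dA (ℤ.≤-trans dS+dA≤dP+dQ (ℤ.+-monoʳ-≤ dP dQ≤dA))

    u≤dQ : u ℤ.≤ dQ
    u≤dQ = +ᶻ-cancelʳ-≤ u dQ dA (ℤ.≤-trans dS+dA≤dP+dQ
      (subst (dP ℤ.+ dQ ℤ.≤_) (ℤ.+-comm dA dQ) (ℤ.+-monoˡ-≤ dQ dP≤dA)))

    u≤dP+dQ : u ℤ.≤ dP ℤ.+ dQ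
    u≤dP+dQ = ℤ.≤-trans
      (subst (ℤ._≤ u ℤ.+ dA) (ℤ.+-identityʳ u) (ℤ.+-monoʳ-≤ u 0≤dA)) dS+dA≤dP+dQ

    bound :
      (p ≡ 0ℤ ⊎ (∀ P → Extension G A (S ∩ A) P → deficiency G f P ℤ.≤ p)) →
      (q ≡ 0ℤ ⊎ (∀ Q → Extension G A̅ (S ∩ A̅) Q → deficiency G f Q ℤ.≤ q)) →
      u ⊓ 0ℤ ℤ.≤ p ⊓ 0ℤ ℤ.+ q ⊓ 0ℤ
    bound (inj₁ p≡0) (inj₁ q≡0) =
      subst₂ (λ p q → u ⊓ 0ℤ ℤ.≤ p ⊓ 0ℤ ℤ.+ q ⊓ 0ℤ) (sym p≡0) (sym q≡0) (ℤ.i⊓j≤j u 0ℤ)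
    bound (inj₁ p≡0) (inj₂ ≤q) =
      subst (λ p → u ⊓ 0ℤ ℤ.≤ p ⊓ 0ℤ ℤ.+ q ⊓ 0ℤ) (sym p≡0)
        (subst (u ⊓ 0ℤ ℤ.≤_) (sym (ℤ.+-identityˡ (q ⊓ 0ℤ)))
          (ℤ.⊓-monoˡ-≤ 0ℤ (ℤ.≤-trans u≤dQ (≤q Q extQ))))
    bound (inj₂ ≤p) (inj₁ q≡0) =
      subst (λ q → u ⊓ 0ℤ ℤ.≤ p ⊓ 0ℤ ℤ.+ q ⊓ 0ℤ) (sym q≡0)
        (subst (u ⊓ 0ℤ ℤ.≤_) (sym (ℤ.+-identityʳ (p ⊓ 0ℤ)))
          (ℤ.⊓-monoˡ-≤ 0ℤ (ℤ.≤-trans u≤dP (≤p P extP))))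
    bound (inj₂ ≤p) (inj₂ ≤q) = ⊓0-subadditive
      (ℤ.≤-trans u≤dP (≤p P extP)) (ℤ.≤-trans u≤dQ (≤q Q extQ))
      (ℤ.≤-trans u≤dP+dQ (ℤ.+-mono-≤ (≤p P extP) (≤q Q extQ)))

-- Linear relaxations

⟨⊥⟩ : ∀ {m} (x : Vector ℝ m) → x ⟨ ⊥ ⟩ ≐ 0ᵣ
⟨⊥⟩ {ℕ.zero}  x = pointwise λ _ → refl
⟨⊥⟩ {ℕ.suc m} x = pointwise λ i → cong (0ℚ ℚ.+_) (at (⟨⊥⟩ (x ∘ suc)) i)

↾-∈ : (x : Vector ℝ m) (Z : Subset m) → ∀ {e} → e ∈ Z → (x ↾ Z) e ≡ x e
↾-∈ x Z {e} e∈Z with lookup Z e | []=⇒lookup e∈Z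
... | true | _ = refl

↾-⟨⟩ : (x : Vector ℝ m) {P Z : Subset m} → P ⊆ Z → (x ↾ Z) ⟨ P ⟩ ≐ x ⟨ P ⟩
↾-⟨⟩ x {P} {Z} P⊆Z = ⟨⟩-cong (x ↾ Z) x P P go
  where
  go : ∀ e → (if lookup P e then (x ↾ Z) e else 0ᵣ) ≡ (if lookup P e then x e else 0ᵣ)
  go e with lookup P e in e∈P
  ... | true  = ↾-∈ x Z (P⊆Z (lookup⇒[]= e P e∈P))
  ... | false = refl

δ⊆E : ∀ (D : Graph n m) S → δ D S ⊆ E D
δ⊆E D S = p∩q⊆p (E D) _

-- Since `x ≤ 1`, the crossing edges contribute at most their number to the cut of an extension;
-- removing them from its constraint leaves the one at `T` with the reduced demand.
restrict-LP : ∀ (G : Graph n m) f {B} → B ⊆ V G → ∀ x →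
  FeasibleLP f G x → FeasibleLP (restriction G f B) (induced G B) (x ↾ E (induced G B))
restrict-LP {n} {m} G f {B} B⊆V x (x-cut , x-box) = cut , box
  where
  D = induced G B
  y = x ↾ E D

  box : ∀ e → e ∈ E D → 0ᵣ ≤ᵣ y e × y e ≤ᵣ 1ᵣ
  box e e∈E = subst (λ r → 0ᵣ ≤ᵣ r × r ≤ᵣ 1ᵣ) (sym (↾-∈ x (E D) e∈E)) (x-box e (p∩q⊆p (E G) _ e∈E))

  module _ {T : Subset n} (T⊆B : T ⊆ B) where

    a : ℤ
    a = + ∣ δ D T ∣

    reduced-cut : ∀ P → Extension G B T P → fromℤ (reduced G f B P ⊓ a) ≤ᵣ y ⟨ δ D T ⟩
    reduced-cut P ext = +ᵣ-cancelʳ-≤ (fromℤ (reduced G f B P ⊓ a)) (y ⟨ δ D T ⟩) (fromℤ c) (begin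
      fromℤ (reduced G f B P ⊓ a) +ᵣ fromℤ c
        ≈⟨ ≐-sym (fromℤ-homo-+ (reduced G f B P ⊓ a) c) ⟩
      fromℤ (reduced G f B P ⊓ a ℤ.+ c)
        ≈⟨ ≡⇒≐ (cong fromℤ (trans (⊓-shift (f P) a c)
                   (cong (λ k → f P ⊓ + k) (sym (∣δ-extension∣ G B⊆V T⊆B ext))))) ⟩
      fromℤ (f P ⊓ + ∣ δ G P ∣)
        ≲⟨ x-cut P (extension-⊆V G B⊆V T⊆B ext) ⟩
      x ⟨ δ G P ⟩
        ≈⟨ ⟨⟩-split x (δ G P) (δ D T) ⊥ Z (extension-split G B⊆V T⊆B ext) ⟩
      x ⟨ δ D T ⟩ +ᵣ x ⟨ ⊥ ⟩ +ᵣ x ⟨ Z ⟩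
        ≲⟨ +ᵣ-mono-≤ {x ⟨ δ D T ⟩ +ᵣ x ⟨ ⊥ ⟩} {y ⟨ δ D T ⟩} {x ⟨ Z ⟩} {fromℤ c} inner
             (⟨⟩≤∣∣ x Z λ e e∈Z → proj₂ (x-box e (δ⊆E G P (p∩q⊆p (δ G P) (δ G B) e∈Z)))) ⟩
      y ⟨ δ D T ⟩ +ᵣ fromℤ c ∎)
      where
      Z = δ[ δ G B ] G P
      c = + ∣ Z ∣
      inner : x ⟨ δ D T ⟩ +ᵣ x ⟨ ⊥ ⟩ ≤ᵣ y ⟨ δ D T ⟩
      inner = begin
        x ⟨ δ D T ⟩ +ᵣ x ⟨ ⊥ ⟩
          ≈⟨ +ᵣ-cong {x ⟨ δ D T ⟩} {x ⟨ δ D T ⟩} {x ⟨ ⊥ ⟩} {0ᵣ} (pointwise λ _ → refl) (⟨⊥⟩ x) ⟩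
        x ⟨ δ D T ⟩ +ᵣ 0ᵣ
          ≈⟨ +ᵣ-identityʳ (x ⟨ δ D T ⟩) ⟩
        x ⟨ δ D T ⟩
          ≈⟨ ≐-sym (↾-⟨⟩ x (δ⊆E D T)) ⟩
        y ⟨ δ D T ⟩ ∎

  ⊆B : ∀ {T} → T ⊆ V D → T ⊆ B
  ⊆B T⊆V i∈T = p∩q⊆q (V G) B (T⊆V i∈T)

  cut : ∀ T → T ⊆ V D → fromℤ (restriction G f B T ⊓ + ∣ δ D T ∣) ≤ᵣ y ⟨ δ D T ⟩
  cut T T⊆V with restriction-cases G f B T
  ... | inj₁ (r≡0 , δ≡⊥) = subst₂ (λ k P → fromℤ k ≤ᵣ y ⟨ P ⟩)
    (sym (cong₂ (λ r k → r ⊓ + k) r≡0 (trans (cong ∣_∣ δ≡⊥) (∣⊥∣≡0 m))))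
    (sym δ≡⊥)
    (≐⇒≤ᵣ {0ᵣ} {y ⟨ ⊥ ⟩} (≐-sym (⟨⊥⟩ y)))
  -- The value of the restriction is attained at one of the two extensions, whose constraint alone
  -- suffices.
  ... | inj₂ r≡max with ℤ.⊔-sel (reduced G f B T) (reduced G f B (T ∪ (V G ─ B)))
  ... | inj₁ max≡ = subst (λ r → fromℤ (r ⊓ + ∣ δ D T ∣) ≤ᵣ y ⟨ δ D T ⟩) (sym (trans r≡max max≡))
    (reduced-cut (⊆B T⊆V) T (inj₁ refl))
  ... | inj₂ max≡ = subst (λ r → fromℤ (r ⊓ + ∣ δ D T ∣) ≤ᵣ y ⟨ δ D T ⟩) (sym (trans r≡max max≡))
    (reduced-cut (⊆B T⊆V) (T ∪ (V G ─ B)) (inj₂ refl))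

-- Positive deficiency caps the demand at `A` to the size of `δ G A`, which coordinates bounded by 1
-- can reach only if all of them equal 1.
saturated : ∀ (G : Graph n m) f x → FeasibleLP f G x →
  ∀ {A} → A ⊆ V G → 0ℤ < deficiency G f A → ∀ e → e ∈ δ G A → x e ≃ᵣ 1ᵣ
saturated G f x (x-cut , x-box) {A} A⊆V 0<dA e e∈δ = ≤ᵣ-antisym (x e) 1ᵣ
  (x≤1 e e∈δ) (⟨⟩-tight x (δ G A) x≤1 ∣δ∣≤x e e∈δ)
  where
  x≤1 : ∀ e → e ∈ δ G A → x e ≤ᵣ 1ᵣ
  x≤1 e e∈δ = proj₂ (x-box e (δ⊆E G A e∈δ))
  ∣δ∣≤f : + ∣ δ G A ∣ ℤ.≤ f A
  ∣δ∣≤f = ℤ.0≤i-j⇒j≤i (ℤ.<⇒≤ 0<dA)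
  ∣δ∣≤x : fromℤ (+ ∣ δ G A ∣) ≤ᵣ x ⟨ δ G A ⟩
  ∣δ∣≤x = subst (λ k → fromℤ k ≤ᵣ x ⟨ δ G A ⟩) (ℤ.i≥j⇒i⊓j≡j ∣δ∣≤f) (x-cut A A⊆V)

-- The cut of `S` splits into two induced cuts, bounded below by the restricted constraints, and
-- crossing edges, each contributing 1; `restrictions-cover` says that this total meets the demand.
combine-LP : ∀ (G : Graph n m) f → WeaklySupermodular (V G) f → Symmetric (V G) f →
  ∀ {A} → MaximumDeficiencyCut G f A → 0ℤ ℤ.≤ deficiency G f A →
  ∀ x → (∀ e → e ∈ E G → 0ᵣ ≤ᵣ x e) → (∀ e → e ∈ δ G A → x e ≃ᵣ 1ᵣ) →
  let A̅ = V G ─ A in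
  FeasibleLP (restriction G f A) (induced G A) (x ↾ E (induced G A)) →
  FeasibleLP (restriction G f A̅) (induced G A̅) (x ↾ E (induced G A̅)) →
  FeasibleLP f G x
combine-LP G f f-wsm f-sym {A} maxA 0≤dA x 0≤x x≃1 (y-cut , y-box) (z-cut , z-box) = cut , box
  where
  A̅ = V G ─ A
  D₁ = induced G A
  D₂ = induced G A̅
  y = x ↾ E D₁
  z = x ↾ E D₂

  box : ∀ e → e ∈ E G → 0ᵣ ≤ᵣ x e × x e ≤ᵣ 1ᵣ
  box e e∈E with E-split G A e∈E
  ... | inj₁ e∈δ        = 0≤x e e∈E , ≃ᵣ⇒≤ᵣ (x e) 1ᵣ (x≃1 e e∈δ)
  ... | inj₂ (inj₁ e∈E₁) = 0≤x e e∈E , subst (_≤ᵣ 1ᵣ) (↾-∈ x (E D₁) e∈E₁) (proj₂ (y-box e e∈E₁))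
  ... | inj₂ (inj₂ e∈E₂) = 0≤x e e∈E , subst (_≤ᵣ 1ᵣ) (↾-∈ x (E D₂) e∈E₂) (proj₂ (z-box e e∈E₂))

  cut : ∀ S → S ⊆ V G → fromℤ (f S ⊓ + ∣ δ G S ∣) ≤ᵣ x ⟨ δ G S ⟩
  cut S S⊆V = begin
    fromℤ (f S ⊓ + ∣ δ G S ∣)
      ≲⟨ fromℤ-mono-≤ (restrictions-cover G f f-wsm f-sym maxA 0≤dA S⊆V) ⟩
    fromℤ ((r₁ ℤ.+ r₂) ℤ.+ c)
      ≈⟨ fromℤ-homo-+ (r₁ ℤ.+ r₂) c ⟩
    fromℤ (r₁ ℤ.+ r₂) +ᵣ fromℤ c
      ≲⟨ +ᵣ-mono-≤ {fromℤ (r₁ ℤ.+ r₂)} {x ⟨ P₁ ⟩ +ᵣ x ⟨ P₂ ⟩} {fromℤ c} {x ⟨ Z ⟩} inner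
           (∣∣≤⟨⟩ x Z λ e e∈Z →
             ≃ᵣ⇒≤ᵣ 1ᵣ (x e) (≃ᵣ-sym (x e) 1ᵣ (x≃1 e (p∩q⊆q (δ G S) (δ G A) e∈Z)))) ⟩
    x ⟨ P₁ ⟩ +ᵣ x ⟨ P₂ ⟩ +ᵣ x ⟨ Z ⟩
      ≈⟨ ≐-sym (⟨⟩-split x (δ G S) P₁ P₂ Z (δ-split G A S)) ⟩
    x ⟨ δ G S ⟩ ∎
    where
    P₁ = δ D₁ (S ∩ A)
    P₂ = δ D₂ (S ∩ A̅)
    Z = δ[ δ G A ] G S
    r₁ = restriction G f A (S ∩ A) ⊓ + ∣ P₁ ∣
    r₂ = restriction G f A̅ (S ∩ A̅) ⊓ + ∣ P₂ ∣
    c = + ∣ Z ∣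

    side : ∀ B → S ∩ B ⊆ V (induced G B)
    side B i∈S∩B = x∈p∩q⁺ (S⊆V (p∩q⊆p S B i∈S∩B) , p∩q⊆q S B i∈S∩B)

    inner : fromℤ (r₁ ℤ.+ r₂) ≤ᵣ x ⟨ P₁ ⟩ +ᵣ x ⟨ P₂ ⟩
    inner = begin
      fromℤ (r₁ ℤ.+ r₂)
        ≈⟨ fromℤ-homo-+ r₁ r₂ ⟩
      fromℤ r₁ +ᵣ fromℤ r₂
        ≲⟨ +ᵣ-mono-≤ {fromℤ r₁} {y ⟨ P₁ ⟩} {fromℤ r₂} {z ⟨ P₂ ⟩}
             (y-cut (S ∩ A) (side A)) (z-cut (S ∩ A̅) (side A̅)) ⟩
      y ⟨ P₁ ⟩ +ᵣ z ⟨ P₂ ⟩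
        ≈⟨ +ᵣ-cong {y ⟨ P₁ ⟩} {x ⟨ P₁ ⟩} {z ⟨ P₂ ⟩} {x ⟨ P₂ ⟩}
             (↾-⟨⟩ x (δ⊆E D₁ (S ∩ A))) (↾-⟨⟩ x (δ⊆E D₂ (S ∩ A̅))) ⟩
      x ⟨ P₁ ⟩ +ᵣ x ⟨ P₂ ⟩ ∎

-- Incidence vectors

χ : Subset m → Vector ℝ m
χ H e = if lookup H e then 1ᵣ else 0ᵣ

χ-box : (H : Subset m) → ∀ e → 0ᵣ ≤ᵣ χ H e × χ H e ≤ᵣ 1ᵣ
χ-box H e with lookup H e
... | true  = fromℤ-mono-≤ {+ 0} {+ 1} (ℤ.+≤+ ℕ.z≤n) , ≤ᵣ-refl 1ᵣ
... | false = ≤ᵣ-refl 0ᵣ , fromℤ-mono-≤ {+ 0} {+ 1} (ℤ.+≤+ ℕ.z≤n)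

-- A separate `y`, only pointwise equal to `χ H`, lets the result apply both to `χ F` itself and to
-- its zero extensions from the two sides.
χ-cut : ∀ (D : Graph n m) H S (y : Vector ℝ m) → (∀ e → y e ≡ χ H e) →
  y ⟨ δ D S ⟩ ≐ fromℤ (+ ∣ δ[ H ] D S ∣)
χ-cut D H S y y≡χ = pointwise λ i →
  trans (at (⟨⟩-cong y (λ _ → 1ᵣ) P (P ∩ H) go) i) (at (1⟨⟩ (P ∩ H)) i)
  where
  P = δ D S
  go : ∀ e → (if lookup P e then y e else 0ᵣ) ≡ (if lookup (P ∩ H) e then 1ᵣ else 0ᵣ)
  go e rewrite lookup-∩ P H e with lookup P e
  ... | true  = y≡χ e
  ... | false = refl

NDP⇒LP : ∀ (D : Graph n m) h H y → (∀ e → y e ≡ χ H e) → FeasibleNDP h D H → FeasibleLP h D y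
NDP⇒LP D h H y y≡χ (_ , H-cut) = cut , λ e _ →
  subst (λ r → 0ᵣ ≤ᵣ r × r ≤ᵣ 1ᵣ) (sym (y≡χ e)) (χ-box H e)
  where
  cut : ∀ S → S ⊆ V D → fromℤ (h S ⊓ + ∣ δ D S ∣) ≤ᵣ y ⟨ δ D S ⟩
  cut S S⊆V = begin
    fromℤ (h S ⊓ + ∣ δ D S ∣)    ≲⟨ fromℤ-mono-≤ (H-cut S S⊆V) ⟩
    fromℤ (+ ∣ δ[ H ] D S ∣)     ≈⟨ ≐-sym (χ-cut D H S y y≡χ) ⟩
    y ⟨ δ D S ⟩                  ∎

LP⇒NDP : ∀ (D : Graph n m) h H y → (∀ e → y e ≡ χ H e) → H ⊆ E D →
  FeasibleLP h D y → FeasibleNDP h D H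
LP⇒NDP D h H y y≡χ H⊆E (y-cut , _) = H⊆E , λ S S⊆V →
  fromℤ-cancel-≤ (h S ⊓ + ∣ δ D S ∣) (+ ∣ δ[ H ] D S ∣) (begin
    fromℤ (h S ⊓ + ∣ δ D S ∣)    ≲⟨ y-cut S S⊆V ⟩
    y ⟨ δ D S ⟩                  ≈⟨ χ-cut D H S y y≡χ ⟩
    fromℤ (+ ∣ δ[ H ] D S ∣)     ∎)

-- Matches the restricted vectors of part (b) with the restricted edge sets of part (a).
χ-↾-induced : ∀ (G : Graph n m) {F} B → F ⊆ E G →
  ∀ e → (χ F ↾ E (induced G B)) e ≡ χ (within G F B) e
χ-↾-induced G {F} B F⊆E e
  rewrite lookup-within G (E G) B e | lookup-within G F B e =
  go (lookup F e) (lookup (E G) e) _ (⊆⇒lookup F⊆E e)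
  where
  go : ∀ f e b → (f ≡ true → e ≡ true) →
    (if e ∧ b then (if f then 1ᵣ else 0ᵣ) else 0ᵣ) ≡ (if f ∧ b then 1ᵣ else 0ᵣ)
  go true  true  b     _ = refl
  go true  false b     h with () ← h refl
  go false true  true  _ = refl
  go false true  false _ = refl
  go false false b     _ = refl

1≰0 : 1ᵣ ≤ᵣ 0ᵣ → Empty
1≰0 1≤0 = contradiction (fromℤ-cancel-≤ (+ 1) (+ 0) 1≤0) λ { (ℤ.+≤+ ()) }

χ≃1⇒∈ : (F : Subset m) → ∀ e → χ F e ≃ᵣ 1ᵣ → e ∈ F
χ≃1⇒∈ F e χ≃1 with lookup F e in e∈F
... | true  = lookup⇒[]= e F e∈F
... | false = ⊥-elim (1≰0 (≃ᵣ⇒≤ᵣ 1ᵣ 0ᵣ (≃ᵣ-sym 0ᵣ 1ᵣ χ≃1)))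

∈⇒χ≃1 : (F : Subset m) → ∀ e → e ∈ F → χ F e ≃ᵣ 1ᵣ
∈⇒χ≃1 F e e∈F = subst (_≃ᵣ 1ᵣ)
  (cong (λ b → if b then 1ᵣ else 0ᵣ) (sym ([]=⇒lookup e∈F)))
  (≤ᵣ-antisym 1ᵣ 1ᵣ (≤ᵣ-refl 1ᵣ) (≤ᵣ-refl 1ᵣ))

within-⊆ : ∀ (G : Graph n m) {F} B → F ⊆ E G → within G F B ⊆ E (induced G B)
within-⊆ G {F} B F⊆E e∈ =
  let e∈F , e∈B = x∈p∩q⁻ F _ e∈ in x∈p∩q⁺ (F⊆E e∈F , e∈B)

-- By normalization the empty set has deficiency 0, so positive deficiency excludes it.
maximum-nonempty : ∀ (G : Graph n m) f → Normalized (V G) f →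
  ∀ A → 0ℤ < deficiency G f A → Nonempty A
maximum-nonempty G f (f⊥≡0 , _) A 0<dA with nonempty? A
... | yes A≢∅ = A≢∅
... | no  A≡∅ with refl ← Empty-unique A≡∅ =
  contradiction (deficiency-⊥ G f ⊥ f⊥≡0 (δ-⊥ G)) (ℤ.<⇒≢ 0<dA ∘ sym)

theorem4p5 :
    ∀ {n m} (G : Graph n m) (f : SetFunction n) →
    WeaklySupermodular (V G) f → Symmetric (V G) f → Normalized (V G) f →
    (∃[ S ] (S ⊆ V G × 0ℤ < deficiency G f S)) →
    ∀ A → MaximumDeficiencyCut G f A →
    let A̅ = V G ─ A
        G[A] = induced G A
        G[A̅] = induced G A̅
        f-A = restriction G f A
        f-A̅ = restriction G f A̅
    in
    (0ℤ < deficiency G f A × Nonempty A × A ⊂ V G)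
    ×
    (∀ (F : Subset m) → F ⊆ E G →
      FeasibleNDP f G F ⇔
      (F ⊇ δ G A
       × FeasibleNDP f-A G[A] (within G F A)
       × FeasibleNDP f-A̅ G[A̅] (within G F A̅)))
    ×
    (∀ (x : Vector ℝ m) → (∀ e → e ∈ E G → 0ᵣ ≤ᵣ x e) →
      FeasibleLP f G x ⇔
      ((∀ e → e ∈ δ G A → x e ≃ᵣ 1ᵣ)
       × FeasibleLP f-A G[A] (x ↾ E G[A])
       × FeasibleLP f-A̅ G[A̅] (x ↾ E G[A̅])))
theorem4p5 {n} {m} G f f-wsm f-sym f-norm (S , S⊆V , 0<dS) A maxA@(A⊆V , max) =
  (0<dA , A≢∅ , A⊆V , proj₁ A̅≢∅ , p─q⊆p (V G) A (proj₂ A̅≢∅) , i∉A) ,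
  (λ F F⊆E → mk⇔ (NDP-to F F⊆E) (NDP-from F F⊆E)) ,
  (λ x 0≤x → mk⇔ (LP-to x) (LP-from x 0≤x))
  where
  A̅ = V G ─ A
  G[A] = induced G A
  G[A̅] = induced G A̅
  f-A = restriction G f A
  f-A̅ = restriction G f A̅

  0<dA : 0ℤ < deficiency G f A
  0<dA = ℤ.<-≤-trans 0<dS (max S S⊆V)

  A≢∅ : Nonempty A
  A≢∅ = maximum-nonempty G f f-norm A 0<dA

  -- By symmetry the complement has the same positive deficiency; a vertex in it witnesses that `A`
  -- is proper.
  A̅≢∅ : Nonempty A̅
  A̅≢∅ = maximum-nonempty G f f-norm A̅
    (subst (0ℤ <_) (sym (deficiency-complement G f f-sym A⊆V)) 0<dA)

  i∉A : proj₁ A̅≢∅ ∉ A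
  i∉A i∈A with () ← trans (sym ([]=⇒lookup (proj₂ A̅≢∅)))
    (trans (lookup-─ (V G) A (proj₁ A̅≢∅))
           (trans (cong (λ a → lookup (V G) (proj₁ A̅≢∅) ∧ not a) ([]=⇒lookup i∈A))
                  (Bool.∧-zeroʳ _)))

  LP-to : ∀ x → FeasibleLP f G x →
    (∀ e → e ∈ δ G A → x e ≃ᵣ 1ᵣ)
    × FeasibleLP f-A G[A] (x ↾ E G[A]) × FeasibleLP f-A̅ G[A̅] (x ↾ E G[A̅])
  LP-to x x-feas = saturated G f x x-feas A⊆V 0<dA
    , restrict-LP G f A⊆V x x-feas , restrict-LP G f (p─q⊆p (V G) A) x x-feas

  LP-from : ∀ x → (∀ e → e ∈ E G → 0ᵣ ≤ᵣ x e) →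
    (∀ e → e ∈ δ G A → x e ≃ᵣ 1ᵣ)
    × FeasibleLP f-A G[A] (x ↾ E G[A]) × FeasibleLP f-A̅ G[A̅] (x ↾ E G[A̅]) →
    FeasibleLP f G x
  LP-from x 0≤x (x≃1 , y-feas , z-feas) =
    combine-LP G f f-wsm f-sym maxA (ℤ.<⇒≤ 0<dA) x 0≤x x≃1 y-feas z-feas

  NDP-to : ∀ F → F ⊆ E G → FeasibleNDP f G F →
    F ⊇ δ G A × FeasibleNDP f-A G[A] (within G F A) × FeasibleNDP f-A̅ G[A̅] (within G F A̅)
  NDP-to F F⊆E F-feas =
    let χ≃1 , y-feas , z-feas = LP-to (χ F) (NDP⇒LP G f F (χ F) (λ _ → refl) F-feas)
    in (λ {e} e∈δ → χ≃1⇒∈ F e (χ≃1 e e∈δ))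
     , LP⇒NDP G[A] f-A (within G F A) (χ F ↾ E G[A])
         (χ-↾-induced G A F⊆E) (within-⊆ G A F⊆E) y-feas
     , LP⇒NDP G[A̅] f-A̅ (within G F A̅) (χ F ↾ E G[A̅])
         (χ-↾-induced G A̅ F⊆E) (within-⊆ G A̅ F⊆E) z-feas

  NDP-from : ∀ F → F ⊆ E G →
    F ⊇ δ G A × FeasibleNDP f-A G[A] (within G F A) × FeasibleNDP f-A̅ G[A̅] (within G F A̅) →
    FeasibleNDP f G F
  NDP-from F F⊆E (δ⊆F , H₁-feas , H₂-feas) = LP⇒NDP G f F (χ F) (λ _ → refl) F⊆E
    (LP-from (χ F) 0≤χ
      ( (λ e e∈δ → ∈⇒χ≃1 F e (δ⊆F e∈δ))
      , NDP⇒LP G[A] f-A (within G F A) (χ F ↾ E G[A]) (χ-↾-induced G A F⊆E) H₁-feas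
      , NDP⇒LP G[A̅] f-A̅ (within G F A̅) (χ F ↾ E G[A̅]) (χ-↾-induced G A̅ F⊆E) H₂-feas))
    where
    0≤χ : ∀ e → e ∈ E G → 0ᵣ ≤ᵣ χ F e
    0≤χ e _ = proj₁ (χ-box F e)
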